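{- Let $n\geq 3$ be an integer, let $a,b\in\mathbb{R}$, and let $t$ be an indeterminate. Put \[ f_{\mathbf c}(t;x)=x^n+t\,(x^2+ax+b)\in\mathbb{R}(t)[x], \] and let $\Delta(f_{\mathbf c}(t;x))$ denote its discriminant with respect to $x$. Put $m_0=\lfloor (n-3)/2\rfloor$ and $m_1=\lceil (n-3)/2\rceil$, and for integers $n\geq 4$ and $0\le k\le m_0$ put \[ S_k=(n-1)^3\binom{n-k-3}{k}a^4-\frac{n(n-1)\left\{ 5n^2-(6k+23)n+10k+24 \right\}}{n-k-3}\binom{n-k-3}{k}a^2b +4n^2(n-2)\binom{n-k-4}{k}b^2 . \] (1) If $n=3$, then \[ \Delta(f_{\mathbf c}(t;x))=t^2\left\{(a^2-4b)t^2-(4a^3-18ab)t-27b^2\right\}. \] (2) If $n\geq 4$, then \[ \Delta(f_{\mathbf c}(t;x))=(-1)^{m_1}t^{n-1}\left\{(n-2)^{n-2}(a^2-4b)t^2+\gamma_{\mathbf c}\,t-n^nb^{n-1}\right\}, \] where \[ \gamma_{\mathbf c}=\begin{cases}\displaystyle\sum_{k=0}^{m_0}(-1)^{n+k}n^k(n-1)^{n-2k-4}(n-2)^k a^{n-2k-4}b^k S_k, & \text{if } a\neq 0, \text{ or } a=0 \text{ and } n \text{ even},\\[2mm] 0, & \text{if } a=0 \text{ and } n \text{ odd}.\end{cases} \]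
   Context: $\lfloor\cdot\rfloor$ and $\lceil\cdot\rceil$ are the floor and ceiling functions. Binomial coefficient conventions: $\binom{N}{0}=1$ for $N\ge 0$, $\binom{N}{m}=0$ if $0\le N<m$, and $\binom{N}{m}=0$ for $m<0$. Powers of the form $a^0$ are interpreted as $1$ (also when $a=0$). -}

module Defs where

open import Level using (Level; _⊔_) renaming (suc to lsuc)
open import Algebra.Bundles using (CommutativeRing)
open import Data.Bool using (Bool; true; false; if_then_else_; _∧_)
open import Data.Nat as ℕ using (ℕ; zero; suc; _∸_; _≡ᵇ_; _<ᵇ_; _≤ᵇ_; ⌊_/2⌋; ⌈_/2⌉)
open import Data.Nat.Combinatorics using (_C_)
open import Data.Integer as ℤ using (ℤ; +_; -[1+_])
open import Data.Fin using (Fin; toℕ; punchIn) renaming (zero to fzero; suc to fsuc)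
open import Relation.Nullary using (¬_)

-- A field of characteristic 0 (ℝ is an instance). Division is given by a
-- total function _⁻¹ whose value is only constrained on nonzero elements.
-- embedding of ℕ into a commutative ring: fromℕ n = 1 + 1 + ... + 1 (n times)
ringFromℕ : ∀ {c ℓ} (R : CommutativeRing c ℓ) → ℕ → CommutativeRing.Carrier R
ringFromℕ R zero = CommutativeRing.0# R
ringFromℕ R (suc n) = CommutativeRing._+_ R (CommutativeRing.1# R) (ringFromℕ R n)

record Char0Field (c ℓ : Level) : Set (lsuc (c ⊔ ℓ)) where
  field
    cring : CommutativeRing c ℓ
  open CommutativeRing cring public
  fromℕ : ℕ → Carrier
  fromℕ = ringFromℕ cring
  field
    _⁻¹ : Carrier → Carrier
    ⁻¹-cong : ∀ {x y} → x ≈ y → x ⁻¹ ≈ y ⁻¹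
    ⁻¹-inverse : ∀ x → ¬ (x ≈ 0#) → (x * (x ⁻¹)) ≈ 1#
    char0 : ∀ n → ¬ (fromℕ (suc n) ≈ 0#)

module FieldDefs {c ℓ : Level} (F : Char0Field c ℓ) where
  open Char0Field F

  fromℤ : ℤ → Carrier
  fromℤ (+ n) = fromℕ n
  fromℤ -[1+ n ] = - fromℕ (suc n)

  _^_ : Carrier → ℕ → Carrier
  x ^ zero = 1#
  x ^ suc n = x * (x ^ n)

  _^ℤ_ : Carrier → ℤ → Carrier
  x ^ℤ (+ n) = x ^ n
  x ^ℤ -[1+ n ] = (x ⁻¹) ^ suc n

  sgn : ℕ → Carrier
  sgn e = (- 1#) ^ e

  sumTo : ℕ → (ℕ → Carrier) → Carrier
  sumTo zero f = f 0
  sumTo (suc m) f = sumTo m f + f (suc m)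

  sumFin : (n : ℕ) → (Fin n → Carrier) → Carrier
  sumFin zero f = 0#
  sumFin (suc n) f = f fzero + sumFin n (λ j → f (fsuc j))

  det : (n : ℕ) → (Fin n → Fin n → Carrier) → Carrier
  det zero M = 1#
  det (suc n) M =
    sumFin (suc n) (λ j → sgn (toℕ j) * (M fzero j * det n (λ i j' → M (fsuc i) (punchIn j j'))))

  -- A polynomial of (formal) degree d is given by its coefficient function
  -- p : ℕ → Carrier, p i = coefficient of x^i (only i ≤ d is used).

  -- Sylvester matrix of p (degree d) and q (degree e); size e + d.
  -- Rows 0..e-1: coefficients of p (highest first) shifted by the row index;
  -- rows e..e+d-1: coefficients of q shifted likewise.
  sylvester : (d : ℕ) → (ℕ → Carrier) → (e : ℕ) → (ℕ → Carrier) →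
              Fin (e ℕ.+ d) → Fin (e ℕ.+ d) → Carrier
  sylvester d p e q i j =
    if toℕ i <ᵇ e
    then (if (toℕ i ≤ᵇ toℕ j) ∧ (toℕ j ≤ᵇ toℕ i ℕ.+ d) then p ((d ℕ.+ toℕ i) ∸ toℕ j) else 0#)
    else (if (r ≤ᵇ toℕ j) ∧ (toℕ j ≤ᵇ r ℕ.+ e) then q ((e ℕ.+ r) ∸ toℕ j) else 0#)
    where r = toℕ i ∸ e

  resultant : (d : ℕ) → (ℕ → Carrier) → (e : ℕ) → (ℕ → Carrier) → Carrier
  resultant d p e q = det (e ℕ.+ d) (sylvester d p e q)

  deriv : (ℕ → Carrier) → (ℕ → Carrier)
  deriv p i = fromℕ (suc i) * p (suc i)

  discriminant : (d : ℕ) → (ℕ → Carrier) → Carrier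
  discriminant d p =
    sgn ⌊ d ℕ.* (d ∸ 1) /2⌋ * ((p d ⁻¹) * resultant d p (d ∸ 1) (deriv p))

  [_] : Bool → Carrier
  [ true ] = 1#
  [ false ] = 0#

  fc : (n : ℕ) (a b t : Carrier) → ℕ → Carrier
  fc n a b t i = [ i ≡ᵇ n ] + t * ([ i ≡ᵇ 2 ] + (a * [ i ≡ᵇ 1 ]) + (b * [ i ≡ᵇ 0 ]))

  Δfc : (n : ℕ) (a b t : Carrier) → Carrier
  Δfc n a b t = discriminant n (fc n a b t)

  m₀ m₁ : ℕ → ℕ
  m₀ n = ⌊ n ∸ 3 /2⌋
  m₁ n = ⌈ n ∸ 3 /2⌉

  S : (n k : ℕ) (a b : Carrier) → Carrier
  S n k a b =
      (fromℕ (n ∸ 1) ^ 3) * fromℕ ((n ∸ k ∸ 3) C k) * (a ^ 4)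
    - (fromℤ (N ℤ.* (N ℤ.- + 1) ℤ.* ((+ 5) ℤ.* N ℤ.* N ℤ.- (+ (6 ℕ.* k ℕ.+ 23)) ℤ.* N ℤ.+ + (10 ℕ.* k ℕ.+ 24)))
        * (fromℕ (n ∸ k ∸ 3) ⁻¹) * fromℕ ((n ∸ k ∸ 3) C k) * (a ^ 2) * b)
    + fromℕ 4 * (fromℕ n ^ 2) * fromℕ (n ∸ 2) * fromℕ ((n ∸ k ∸ 4) C k) * (b ^ 2)
    where N = + n

  γsum : (n : ℕ) (a b : Carrier) → Carrier
  γsum n a b = sumTo (m₀ n) λ k →
      sgn (n ℕ.+ k) * (fromℕ n ^ k) * (fromℕ (n ∸ 1) ^ℤ e k) * (fromℕ (n ∸ 2) ^ k)
        * (a ^ℤ e k) * (b ^ k) * S n k a b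
    where
    e : ℕ → ℤ
    e k = (+ n) ℤ.- (+ (2 ℕ.* k ℕ.+ 4))

  rhs₂ : (n : ℕ) (a b t γ : Carrier) → Carrier
  rhs₂ n a b t γ =
    sgn (m₁ n) * (t ^ (n ∸ 1)) *
      ((fromℕ (n ∸ 2) ^ (n ∸ 2)) * ((a ^ 2) - fromℕ 4 * b) * (t ^ 2) + γ * t
        - (fromℕ n ^ n) * (b ^ (n ∸ 1)))

  rhs₁ : (a b t : Carrier) → Carrier
  rhs₁ a b t =
    (t ^ 2) * (((a ^ 2) - fromℕ 4 * b) * (t ^ 2)
      - (fromℕ 4 * (a ^ 3) - fromℕ 18 * a * b) * t - fromℕ 27 * (b ^ 2))

-- Write c = n - 2 and q = c x² + (n-1) a x + n b, so that n f - x f' = t q.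
-- Gaussian elimination of the Sylvester matrix with the rows of f as pivots
-- turns the rows of f' into shifts of - t q; using those as pivots leaves the
-- 2 × 2 determinant of the remainders of f and f' modulo q, so that
-- n Res(f, f') = t^(n-1) c^(n-1) N(f'), with N the norm of f' modulo q.
-- Up to powers of - c, the remainder of x^(n-1) modulo q is given by the Lucas
-- sequence U_0 = 1, U_1 = (n-1) a, U_(k+2) = (n-1) a U_(k+1) - n c b U_k, which
-- yields the coefficient γ of t.  On the other side
-- U_p = Σ_k C(p-k, k) ((n-1) a)^(p-2k) (- n c b)^k, and the fraction in S_k
-- equals n (n-1) ((4n-6) C(n-k-3, k) + (n-2) C(n-k-4, k)), so the sum in the
-- theorem is a combination of U_(n-3) and U_(n-4).

module Submission where

open import Defs
open import Level using (Level; _⊔_)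
open import Algebra.Solver.Ring.AlmostCommutativeRing using (fromCommutativeRing; _-Raw-AlmostCommutative⟶_)
import Algebra.Properties.Ring as RingProps
import Algebra.Solver.Ring as RingSolver
open import Data.Bool using (if_then_else_; _∧_)
open import Data.Fin using (Fin; toℕ; punchIn; inject₁) renaming (zero to fzero; suc to fsuc)
open import Data.Fin.Properties using (toℕ-inject₁; toℕ<n)
open import Data.Integer as ℤ using (ℤ; +_; -[1+_])
import Data.Integer.Properties as ℤₚ
open import Data.List using (List; []; _∷_; _++_)
open import Data.List.Relation.Binary.Pointwise using (Pointwise; []; _∷_; ++⁺)
open import Data.Maybe using () renaming (map to map?)
open import Data.Nat as ℕ using (ℕ; zero; suc; z≤n; s≤s; _≤_; _≤ᵇ_; _<ᵇ_; _≡ᵇ_; _∸_; ⌊_/2⌋; ⌈_/2⌉)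
open import Data.Nat.Combinatorics using (_C_; nCn≡1; nC1≡n; nCk≡nC[n∸k]; nCk+nC[k+1]≡[n+1]C[k+1]; k>n⇒nCk≡0)
open import Data.Nat.Divisibility using (_∣_; divides; ∣m+n∣m⇒∣n)
import Data.Nat.Properties as ℕₚ
open import Data.Nat.Solver using (module +-*-Solver)
open import Data.Product using (_×_; _,_; proj₁; proj₂; ∃-syntax)
open import Data.Sum using (_⊎_; inj₁; inj₂)
open import Data.Vec.Functional using (updateAt)
open import Data.Vec.Functional.Properties using (updateAt-updates; updateAt-minimal)
open import Function using (const; _∘_)
open import Relation.Nullary using (¬_; contradiction; yes; no)
open import Relation.Nullary.Decidable using (dec⇒maybe)
open import Relation.Binary.PropositionalEquality as ≡ using (_≡_; _≢_)
import Relation.Binary.Reasoning.Setoid as SetoidReasoning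

-- The parameter t is an arbitrary field element, possibly zero, so the elimination may divide by
-- none of t, a, b. Its only pivots are f, which is monic, and q, whose leading coefficient n - 2 is
-- invertible in characteristic 0; the factor - t of a reduced row is pulled out as a scalar. There
-- is no division by n either: the 2 × 2 determinant of the remainders of f and f' is expanded as it
-- stands. Since `det` is expansion along the top row, alternation and row operations have to be
-- derived from that expansion first. On the binomial side the obstacle is the exponent n - 2k - 4,
-- which is - 1 for odd n and the last k. There the part of S_k with C(n-k-3, k) supplies a factor
-- (n-1) a that cancels the inverse, while C(n-k-4, k) vanishes. This dictates how S_k is split into
-- two Lucas summands.

-- Column indices of iterated minors

punchIn-inject₁ : ∀ {n} (j k : Fin n) → toℕ j ℕ.≤ toℕ k → punchIn (inject₁ j) k ≡ fsuc k
punchIn-inject₁ fzero k _ = ≡.refl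
punchIn-inject₁ (fsuc j) (fsuc k) (s≤s j≤k) = ≡.cong fsuc (punchIn-inject₁ j k j≤k)

punchIn-suc : ∀ {n} (j k : Fin n) → toℕ j ℕ.≤ toℕ k → punchIn (fsuc k) j ≡ inject₁ j
punchIn-suc fzero k _ = ≡.refl
punchIn-suc (fsuc j) (fsuc k) (s≤s j≤k) = ≡.cong fsuc (punchIn-suc j k j≤k)

-- The cosimplicial identity for the injections `punchIn`: two columns may be deleted in either
-- order. It makes the two complementary minors in `det-equal-top` coincide.
punchIn-punchIn : ∀ {n} (j k : Fin (suc n)) (i : Fin n) → toℕ j ℕ.≤ toℕ k →
  punchIn (inject₁ j) (punchIn k i) ≡ punchIn (fsuc k) (punchIn j i)
punchIn-punchIn fzero k i _ = ≡.refl
punchIn-punchIn (fsuc j) (fsuc k) fzero _ = ≡.refl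
punchIn-punchIn (fsuc j) (fsuc k) (fsuc i) (s≤s j≤k) = ≡.cong fsuc (punchIn-punchIn j k i j≤k)

≤ᵇ-suc : ∀ i j → (suc i ≤ᵇ suc j) ≡ (i ≤ᵇ j)
≤ᵇ-suc zero j = ≡.refl
≤ᵇ-suc (suc i) j = ≡.refl

-- Halves, binomial coefficients and parity

module Arithmetic where
  open +-*-Solver

  ⌊n+2m/2⌋ : ∀ n m → ⌊ n ℕ.+ (m ℕ.+ m) /2⌋ ≡ ⌊ n /2⌋ ℕ.+ m
  ⌊n+2m/2⌋ n zero = ≡.trans (≡.cong ⌊_/2⌋ (ℕₚ.+-identityʳ n)) (≡.sym (ℕₚ.+-identityʳ _))
  ⌊n+2m/2⌋ n (suc m) = ≡.trans
    (≡.cong ⌊_/2⌋ (solve 2 (λ n m → n :+ (con 1 :+ m :+ (con 1 :+ m)) := con 2 :+ (n :+ (m :+ m))) ≡.refl n m))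
    (≡.trans (≡.cong suc (⌊n+2m/2⌋ n m)) (≡.sym (ℕₚ.+-suc _ m)))

  -- The increment 7 + 2p of the half is odd, which flips the sign of the discriminant when n grows
  -- by 2.
  ⌊n[n-1]/2⌋-step : ∀ p → ⌊ (5 ℕ.+ p) ℕ.* (4 ℕ.+ p) /2⌋ ≡ ⌊ (3 ℕ.+ p) ℕ.* (2 ℕ.+ p) /2⌋ ℕ.+ (7 ℕ.+ (p ℕ.+ p))
  ⌊n[n-1]/2⌋-step p = ≡.trans
    (≡.cong ⌊_/2⌋ (solve 1 (λ p → let m = con 7 :+ (p :+ p) in
      (con 5 :+ p) :* (con 4 :+ p) := (con 3 :+ p) :* (con 2 :+ p) :+ (m :+ m)) ≡.refl p))
    (⌊n+2m/2⌋ ((3 ℕ.+ p) ℕ.* (2 ℕ.+ p)) (7 ℕ.+ (p ℕ.+ p)))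

  nC0≡1 : ∀ n → n C 0 ≡ 1
  nC0≡1 n = ≡.trans (nCk≡nC[n∸k] {0} {n} z≤n) (nCn≡1 n)

  -- Pascal's rule splits the left side; after both induction hypotheses the terms recombine by
  -- Pascal's rule one row higher in the triangle.
  C-absorption : ∀ m k → suc k ℕ.* (suc m C suc k) ≡ suc m ℕ.* (m C k)
  C-absorption zero zero = ≡.refl
  C-absorption zero (suc k) = ℕₚ.*-zeroʳ k
  C-absorption (suc m) zero = ≡.trans (≡.trans (ℕₚ.*-identityˡ _) (nC1≡n (suc (suc m))))
    (≡.sym (≡.trans (≡.cong (suc (suc m) ℕ.*_) (nC0≡1 (suc m))) (ℕₚ.*-identityʳ _)))
  C-absorption (suc m) (suc k) = begin
    (2 ℕ.+ k) ℕ.* (suc (suc m) C suc (suc k))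
      ≡⟨ ≡.cong ((2 ℕ.+ k) ℕ.*_) (nCk+nC[k+1]≡[n+1]C[k+1] (suc m) (suc k)) ⟨
    (2 ℕ.+ k) ℕ.* (A ℕ.+ (suc m C suc (suc k)))
      ≡⟨ solve 3 (λ k x y → (con 2 :+ k) :* (x :+ y) := x :+ (con 1 :+ k) :* x :+ (con 2 :+ k) :* y) ≡.refl k A (suc m C suc (suc k)) ⟩
    A ℕ.+ suc k ℕ.* A ℕ.+ (2 ℕ.+ k) ℕ.* (suc m C suc (suc k))
      ≡⟨ ≡.cong₂ (λ x y → A ℕ.+ x ℕ.+ y) (C-absorption m k) (C-absorption m (suc k)) ⟩
    A ℕ.+ suc m ℕ.* (m C k) ℕ.+ suc m ℕ.* (m C suc k)
      ≡⟨ solve 4 (λ a m x y → a :+ m :* x :+ m :* y := a :+ m :* (x :+ y)) ≡.refl A (suc m) (m C k) (m C suc k) ⟩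
    A ℕ.+ suc m ℕ.* ((m C k) ℕ.+ (m C suc k))
      ≡⟨ ≡.cong (λ x → A ℕ.+ suc m ℕ.* x) (nCk+nC[k+1]≡[n+1]C[k+1] m k) ⟩
    A ℕ.+ suc m ℕ.* A ∎
    where
    open ≡.≡-Reasoning
    A : ℕ
    A = suc m C suc k

  -- (m+1) C(m,k) = (m+1-k) C(m+1,k), with the subtraction moved to the left.
  C-absorption′ : ∀ m k → suc m ℕ.* (m C k) ℕ.+ k ℕ.* (suc m C k) ≡ suc m ℕ.* (suc m C k)
  C-absorption′ m zero = ≡.trans (ℕₚ.+-identityʳ _) (≡.cong (suc m ℕ.*_) (≡.trans (nC0≡1 m) (≡.sym (nC0≡1 (suc m)))))
  C-absorption′ m (suc k) = begin
    suc m ℕ.* (m C suc k) ℕ.+ suc k ℕ.* (suc m C suc k) ≡⟨ ≡.cong (suc m ℕ.* (m C suc k) ℕ.+_) (C-absorption m k) ⟩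
    suc m ℕ.* (m C suc k) ℕ.+ suc m ℕ.* (m C k)         ≡⟨ ℕₚ.*-distribˡ-+ (suc m) (m C suc k) (m C k) ⟨
    suc m ℕ.* ((m C suc k) ℕ.+ (m C k))                 ≡⟨ ≡.cong (suc m ℕ.*_) (≡.trans (ℕₚ.+-comm (m C suc k) _) (nCk+nC[k+1]≡[n+1]C[k+1] m k)) ⟩
    suc m ℕ.* (suc m C suc k)                           ∎
    where open ≡.≡-Reasoning

open Arithmetic

parity : ∀ m → (∃[ k ] m ≡ k ℕ.+ k) ⊎ (∃[ k ] m ≡ suc (k ℕ.+ k))
parity zero = inj₁ (0 , ≡.refl)
parity (suc m) with parity m
... | inj₁ (k , ≡.refl) = inj₂ (k , ≡.refl)
... | inj₂ (k , ≡.refl) = inj₁ (suc k , ≡.cong suc (≡.sym (ℕₚ.+-suc k k)))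

2∣k+k : ∀ k → 2 ∣ k ℕ.+ k
2∣k+k k = divides k (≡.trans (≡.cong (k ℕ.+_) (≡.sym (ℕₚ.+-identityʳ k))) (ℕₚ.*-comm 2 k))

2∤1+k+k : ∀ k → ¬ 2 ∣ suc (k ℕ.+ k)
2∤1+k+k k 2∣ with ∣m+n∣m⇒∣n (≡.subst (2 ∣_) (ℕₚ.+-comm 1 (k ℕ.+ k)) 2∣) (2∣k+k k)
... | divides zero ()
... | divides (suc q) ()

k≤⌊n/2⌋⇒k+k≤n : ∀ {k} n → k ℕ.≤ ⌊ n /2⌋ → k ℕ.+ k ℕ.≤ n
k≤⌊n/2⌋⇒k+k≤n {zero} n _ = z≤n
k≤⌊n/2⌋⇒k+k≤n {suc k} (suc (suc n)) (s≤s k≤) =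
  s≤s (≡.subst (ℕ._≤ suc n) (≡.sym (ℕₚ.+-suc k k)) (s≤s (k≤⌊n/2⌋⇒k+k≤n n k≤)))

module FieldLemmas {c ℓ : Level} (F : Char0Field c ℓ) where
  open Char0Field F hiding (zero)
  open FieldDefs F
  open RingProps ring
  open SetoidReasoning setoid

  -- The integers inside the field, and the ring solver

  fromℕ-+ : ∀ m n → fromℕ (m ℕ.+ n) ≈ fromℕ m + fromℕ n
  fromℕ-+ zero n = sym (+-identityˡ _)
  fromℕ-+ (suc m) n = trans (+-congˡ (fromℕ-+ m n)) (sym (+-assoc _ _ _))

  fromℕ-* : ∀ m n → fromℕ (m ℕ.* n) ≈ fromℕ m * fromℕ n
  fromℕ-* zero n = sym (zeroˡ _)
  fromℕ-* (suc m) n = begin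
    fromℕ (n ℕ.+ m ℕ.* n)            ≈⟨ fromℕ-+ n (m ℕ.* n) ⟩
    fromℕ n + fromℕ (m ℕ.* n)        ≈⟨ +-cong (sym (*-identityˡ _)) (fromℕ-* m n) ⟩
    1# * fromℕ n + fromℕ m * fromℕ n ≈⟨ sym (distribʳ _ _ _) ⟩
    (1# + fromℕ m) * fromℕ n         ∎

  fromℤ-⊖ : ∀ m n → fromℤ (m ℤ.⊖ n) ≈ fromℕ m - fromℕ n
  fromℤ-⊖ m zero = sym (trans (+-congˡ -0#≈0#) (+-identityʳ _))
  fromℤ-⊖ zero (suc n) = sym (+-identityˡ _)
  fromℤ-⊖ (suc m) (suc n) = begin
    fromℤ (suc m ℤ.⊖ suc n)     ≈⟨ reflexive (≡.cong fromℤ (ℤₚ.[1+m]⊖[1+n]≡m⊖n m n)) ⟩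
    fromℤ (m ℤ.⊖ n)             ≈⟨ fromℤ-⊖ m n ⟩
    fromℕ m - fromℕ n           ≈⟨ +-congʳ (sym (+-identityˡ _)) ⟩
    0# + fromℕ m - fromℕ n      ≈⟨ +-congʳ (+-congʳ (sym (-‿inverseˡ 1#))) ⟩
    - 1# + 1# + fromℕ m - fromℕ n ≈⟨ +-congʳ (trans (+-assoc _ _ _) (+-comm _ _)) ⟩
    1# + fromℕ m - 1# - fromℕ n ≈⟨ +-assoc _ _ _ ⟩
    1# + fromℕ m + (- 1# - fromℕ n) ≈⟨ +-congˡ (-‿+-comm _ _) ⟩
    1# + fromℕ m - (1# + fromℕ n) ∎

  fromℤ-neg : ∀ i → fromℤ (ℤ.- i) ≈ - fromℤ i
  fromℤ-neg (+ zero) = sym -0#≈0#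
  fromℤ-neg (+ suc n) = refl
  fromℤ-neg -[1+ n ] = sym (-‿involutive _)

  fromℤ-+ : ∀ i j → fromℤ (i ℤ.+ j) ≈ fromℤ i + fromℤ j
  fromℤ-+ (+ m) (+ n) = fromℕ-+ m n
  fromℤ-+ (+ m) -[1+ n ] = fromℤ-⊖ m (suc n)
  fromℤ-+ -[1+ m ] (+ n) = trans (fromℤ-⊖ n (suc m)) (+-comm _ _)
  fromℤ-+ -[1+ m ] -[1+ n ] = begin
    - fromℕ (suc (suc (m ℕ.+ n)))   ≈⟨ -‿cong (reflexive (≡.cong fromℕ (≡.sym (≡.cong suc (ℕₚ.+-suc m n))))) ⟩
    - fromℕ (suc m ℕ.+ suc n)       ≈⟨ -‿cong (fromℕ-+ (suc m) (suc n)) ⟩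
    - (fromℕ (suc m) + fromℕ (suc n)) ≈⟨ sym (-‿+-comm _ _) ⟩
    - fromℕ (suc m) - fromℕ (suc n) ∎

  fromℤ-*⁺ : ∀ m j → fromℤ (+ m ℤ.* j) ≈ fromℕ m * fromℤ j
  fromℤ-*⁺ m (+ n) = trans (reflexive (≡.cong fromℤ (≡.sym (ℤₚ.pos-* m n)))) (fromℕ-* m n)
  fromℤ-*⁺ m -[1+ n ] = begin
    fromℤ (+ m ℤ.* (ℤ.- (+ suc n)))  ≈⟨ reflexive (≡.cong fromℤ (≡.sym (ℤₚ.neg-distribʳ-* (+ m) (+ suc n)))) ⟩
    fromℤ (ℤ.- (+ m ℤ.* + suc n))    ≈⟨ fromℤ-neg (+ m ℤ.* + suc n) ⟩
    - fromℤ (+ m ℤ.* + suc n)        ≈⟨ -‿cong (fromℤ-*⁺ m (+ suc n)) ⟩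
    - (fromℕ m * fromℕ (suc n))      ≈⟨ -‿distribʳ-* _ _ ⟩
    fromℕ m * - fromℕ (suc n)        ∎

  fromℤ-* : ∀ i j → fromℤ (i ℤ.* j) ≈ fromℤ i * fromℤ j
  fromℤ-* (+ m) j = fromℤ-*⁺ m j
  fromℤ-* -[1+ m ] j = begin
    fromℤ (ℤ.- (+ suc m) ℤ.* j)    ≈⟨ reflexive (≡.cong fromℤ (≡.sym (ℤₚ.neg-distribˡ-* (+ suc m) j))) ⟩
    fromℤ (ℤ.- (+ suc m ℤ.* j))    ≈⟨ fromℤ-neg (+ suc m ℤ.* j) ⟩
    - fromℤ (+ suc m ℤ.* j)        ≈⟨ -‿cong (fromℤ-*⁺ (suc m) j) ⟩
    - (fromℕ (suc m) * fromℤ j)    ≈⟨ -‿distribˡ-* _ _ ⟩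
    - fromℕ (suc m) * fromℤ j      ∎

  -- Integer coefficients give the solver a decidable comparison, although `≈` is not assumed
  -- decidable, and `con (+ m)` evaluates by definition to the numeral `fromℕ m`.
  ℤ-morphism : ℤ.+-*-rawRing -Raw-AlmostCommutative⟶ fromCommutativeRing cring
  ℤ-morphism = record
    { ⟦_⟧ = fromℤ
    ; +-homo = fromℤ-+
    ; *-homo = fromℤ-*
    ; -‿homo = fromℤ-neg
    ; 0-homo = refl
    ; 1-homo = +-identityʳ 1#
    }

  module Solver = RingSolver ℤ.+-*-rawRing (fromCommutativeRing cring) ℤ-morphism
    (λ i j → map? (λ eq → reflexive (≡.cong fromℤ eq)) (dec⇒maybe (i ℤ.≟ j)))
  open Solver using (Polynomial; solve; _:=_; _:+_; _:*_; _:-_; :-_; _:^_; con)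

  -- The constant con (+ 1) denotes 1# + 0#, whereas this one denotes 1# itself.
  :1 : ∀ {n} → Polynomial n
  :1 = con (+ 0) :^ 0

  -- Determinants

  Matrix : ℕ → Set c
  Matrix n = Fin n → Fin n → Carrier

  sumFin-cong : ∀ {n} {f g : Fin n → Carrier} → (∀ j → f j ≈ g j) → sumFin n f ≈ sumFin n g
  sumFin-cong {zero} f≈g = refl
  sumFin-cong {suc n} f≈g = +-cong (f≈g fzero) (sumFin-cong (f≈g ∘ fsuc))

  sumFin-zero : ∀ {n} {f : Fin n → Carrier} → (∀ j → f j ≈ 0#) → sumFin n f ≈ 0#
  sumFin-zero {zero} f≈0 = refl
  sumFin-zero {suc n} f≈0 = trans (+-cong (f≈0 fzero) (sumFin-zero (f≈0 ∘ fsuc))) (+-identityˡ 0#)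

  sumFin-*ˡ : ∀ {n} (α : Carrier) (f : Fin n → Carrier) → α * sumFin n f ≈ sumFin n (λ j → α * f j)
  sumFin-*ˡ {zero} α f = zeroʳ α
  sumFin-*ˡ {suc n} α f = trans (distribˡ _ _ _) (+-congˡ (sumFin-*ˡ α (f ∘ fsuc)))

  sumFin-+ : ∀ {n} (f g : Fin n → Carrier) → sumFin n (λ j → f j + g j) ≈ sumFin n f + sumFin n g
  sumFin-+ {zero} f g = sym (+-identityˡ 0#)
  sumFin-+ {suc n} f g = trans (+-congˡ (sumFin-+ (f ∘ fsuc) (g ∘ fsuc)))
    (solve 4 (λ x y u v → (x :+ y) :+ (u :+ v) := (x :+ u) :+ (y :+ v)) refl _ _ _ _)

  sumFin-linear : ∀ {n} {f g h : Fin n → Carrier} α β → (∀ j → h j ≈ α * f j + β * g j) →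
                  sumFin n h ≈ α * sumFin n f + β * sumFin n g
  sumFin-linear {n} {f} {g} {h} α β h≈ = begin
    sumFin n h                                              ≈⟨ sumFin-cong h≈ ⟩
    sumFin n (λ j → α * f j + β * g j)                      ≈⟨ sumFin-+ (λ j → α * f j) (λ j → β * g j) ⟩
    sumFin n (λ j → α * f j) + sumFin n (λ j → β * g j)     ≈⟨ sym (+-cong (sumFin-*ˡ α f) (sumFin-*ˡ β g)) ⟩
    α * sumFin n f + β * sumFin n g                         ∎

  minor : ∀ {n} → Matrix (suc n) → Fin (suc n) → Matrix n
  minor M j i k = M (fsuc i) (punchIn j k)

  term : ∀ {n} → Matrix (suc n) → Fin (suc n) → Carrier
  term {n} M j = sgn (toℕ j) * (M fzero j * det n (minor M j))

  det-cong : ∀ {n} {A B : Matrix n} → (∀ i j → A i j ≈ B i j) → det n A ≈ det n B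
  det-cong {zero} A≈B = refl
  det-cong {suc n} {A} {B} A≈B = sumFin-cong {f = term A} {term B} λ j →
    *-congˡ {sgn (toℕ j)} (*-cong (A≈B fzero j) (det-cong λ i k → A≈B (fsuc i) (punchIn j k)))

  -- For the top row, linearity is visible in the expansion; for a lower row it is inherited from
  -- every minor.
  det-linear : ∀ {n} (r : Fin n) {α β} {M A B : Matrix n} →
    (∀ j → M r j ≈ α * A r j + β * B r j) →
    (∀ i → i ≢ r → ∀ j → M i j ≈ A i j) →
    (∀ i → i ≢ r → ∀ j → M i j ≈ B i j) →
    det n M ≈ α * det n A + β * det n B
  det-linear {suc n} fzero {α} {β} {M} {A} {B} row sameA sameB = sumFin-linear {f = term A} {term B} {term M} α β λ j → begin
    sgn (toℕ j) * (M fzero j * det n (minor M j))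
      ≈⟨ *-congˡ (*-congʳ (row j)) ⟩
    sgn (toℕ j) * ((α * A fzero j + β * B fzero j) * det n (minor M j))
      ≈⟨ solve 6 (λ s α β x y m → s :* ((α :* x :+ β :* y) :* m) := α :* (s :* (x :* m)) :+ β :* (s :* (y :* m)))
           refl (sgn (toℕ j)) α β (A fzero j) (B fzero j) (det n (minor M j)) ⟩
    α * (sgn (toℕ j) * (A fzero j * det n (minor M j))) + β * (sgn (toℕ j) * (B fzero j * det n (minor M j)))
      ≈⟨ +-cong (*-congˡ (*-congˡ (*-congˡ (det-cong λ i k → sameA (fsuc i) (λ ()) (punchIn j k)))))
                (*-congˡ (*-congˡ (*-congˡ (det-cong λ i k → sameB (fsuc i) (λ ()) (punchIn j k))))) ⟩
    α * (sgn (toℕ j) * (A fzero j * det n (minor A j))) + β * (sgn (toℕ j) * (B fzero j * det n (minor B j))) ∎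
  det-linear {suc n} (fsuc r) {α} {β} {M} {A} {B} row sameA sameB = sumFin-linear {f = term A} {term B} {term M} α β λ j → begin
    sgn (toℕ j) * (M fzero j * det n (minor M j))
      ≈⟨ *-congˡ (*-congˡ (det-linear r (row ∘ punchIn j)
           (λ i i≢r → sameA (fsuc i) (λ { ≡.refl → i≢r ≡.refl }) ∘ punchIn j)
           (λ i i≢r → sameB (fsuc i) (λ { ≡.refl → i≢r ≡.refl }) ∘ punchIn j))) ⟩
    sgn (toℕ j) * (M fzero j * (α * det n (minor A j) + β * det n (minor B j)))
      ≈⟨ solve 6 (λ s α β x y m → s :* (m :* (α :* x :+ β :* y)) := α :* (s :* (m :* x)) :+ β :* (s :* (m :* y)))
           refl (sgn (toℕ j)) α β (det n (minor A j)) (det n (minor B j)) (M fzero j) ⟩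
    α * (sgn (toℕ j) * (M fzero j * det n (minor A j))) + β * (sgn (toℕ j) * (M fzero j * det n (minor B j)))
      ≈⟨ +-cong (*-congˡ (*-congˡ (*-congʳ (sameA fzero (λ ()) j)))) (*-congˡ (*-congˡ (*-congʳ (sameB fzero (λ ()) j)))) ⟩
    α * (sgn (toℕ j) * (A fzero j * det n (minor A j))) + β * (sgn (toℕ j) * (B fzero j * det n (minor B j))) ∎

  -- The pairs (j , punchIn j k) run through the ordered pairs of distinct
  -- indices, and transposing such a pair exchanges (inject₁ j , k) and (suc k , j).
  sumFin-antisymmetric : ∀ {n} (H : Fin (suc n) → Fin n → Carrier) →
    (∀ j k → toℕ j ℕ.≤ toℕ k → H (inject₁ j) k + H (fsuc k) j ≈ 0#) →
    sumFin (suc n) (λ j → sumFin n (H j)) ≈ 0#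
  sumFin-antisymmetric {zero} H anti = +-identityˡ 0#
  sumFin-antisymmetric {suc n} H anti = begin
    sumFin (suc n) (H fzero) + sumFin (suc n) (λ j → H (fsuc j) fzero + sumFin n (λ k → H (fsuc j) (fsuc k)))
      ≈⟨ +-congˡ (sumFin-+ (λ j → H (fsuc j) fzero) (λ j → sumFin n (λ k → H (fsuc j) (fsuc k)))) ⟩
    sumFin (suc n) (H fzero) + (sumFin (suc n) (λ j → H (fsuc j) fzero) + rest)
      ≈⟨ sym (+-assoc _ _ _) ⟩
    sumFin (suc n) (H fzero) + sumFin (suc n) (λ j → H (fsuc j) fzero) + rest
      ≈⟨ +-cong (trans (sym (sumFin-+ (H fzero) (λ j → H (fsuc j) fzero))) (sumFin-zero λ k → anti fzero k z≤n))
                (sumFin-antisymmetric (λ j k → H (fsuc j) (fsuc k)) (λ j k j≤k → anti (fsuc j) (fsuc k) (s≤s j≤k))) ⟩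
    0# + 0#
      ≈⟨ +-identityˡ 0# ⟩
    0# ∎
    where
    rest : Carrier
    rest = sumFin (suc n) (λ j → sumFin n (λ k → H (fsuc j) (fsuc k)))

  -- Expanding twice gives a sum over ordered pairs of distinct columns. Exchanging a pair keeps the
  -- complementary minor and the product of entries but reverses the sign.
  det-equal-top : ∀ {n} (M : Matrix (suc (suc n))) → (∀ j → M fzero j ≈ M (fsuc fzero) j) → det (suc (suc n)) M ≈ 0#
  det-equal-top {n} M eq = begin
    det (suc (suc n)) M
      ≈⟨ sumFin-cong {f = term M} (λ j → trans (*-congˡ (sumFin-*ˡ (M fzero j) (term (minor M j))))
                                            (sumFin-*ˡ (sgn (toℕ j)) (λ k → M fzero j * term (minor M j) k))) ⟩
    sumFin (suc (suc n)) (λ j → sumFin (suc n) (H j))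
      ≈⟨ sumFin-antisymmetric H anti ⟩
    0# ∎
    where
    H : (j : Fin (suc (suc n))) (k : Fin (suc n)) → Carrier
    H j k = sgn (toℕ j) * (M fzero j * term (minor M j) k)
    anti : ∀ j k → toℕ j ℕ.≤ toℕ k → H (inject₁ j) k + H (fsuc k) j ≈ 0#
    anti j k j≤k = trans
      (+-cong
        (*-cong (reflexive (≡.cong sgn (toℕ-inject₁ j))) (*-congˡ (*-congˡ (*-cong
          (trans (reflexive (≡.cong (M (fsuc fzero)) (punchIn-inject₁ j k j≤k))) (sym (eq (fsuc k))))
          (det-cong λ i l → reflexive (≡.cong (M (fsuc (fsuc i))) (punchIn-punchIn j k l j≤k)))))))
        (*-congˡ (*-congˡ (*-congˡ (*-congʳ
          (trans (reflexive (≡.cong (M (fsuc fzero)) (punchIn-suc j k j≤k))) (sym (eq (inject₁ j)))))))))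
      (trans
        -- The sign of `fsuc k` is `(- 1#) * sgn (toℕ k)`; with `1#` as the variable `o`, the sum
        -- acquires the factor 1 - o.
        (solve 6 (λ s t x y m o → s :* (x :* (t :* (y :* m))) :+ (:- o :* t) :* (y :* (s :* (x :* m)))
            := s :* (x :* (t :* (y :* m))) :* (con (+ 1) :- o)) refl
          (sgn (toℕ j)) (sgn (toℕ k)) (M fzero (inject₁ j)) (M fzero (fsuc k)) (det n (minor (minor M (fsuc k)) j)) 1#)
        (trans (*-congˡ (trans (+-congʳ (+-identityʳ 1#)) (-‿inverseʳ 1#))) (zeroʳ _)))

  topRows : ∀ {n} {A : Set c} (u v : A) (W : Fin n → A) → Fin (suc (suc n)) → A
  topRows u v W fzero = u
  topRows u v W (fsuc fzero) = v
  topRows u v W (fsuc (fsuc i)) = W i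

  -- Polarization: the determinant with u + v in both top rows is 0, and so are two of its four
  -- bilinear parts.
  det-swap-top : ∀ {n} (u v : Fin (suc (suc n)) → Carrier) (W : Fin n → Fin (suc (suc n)) → Carrier) →
    det (suc (suc n)) (topRows u v W) ≈ - det (suc (suc n)) (topRows v u W)
  det-swap-top {n} u v W = begin
    D u v          ≈⟨ solve 4 (λ x y z w → x := (con (+ 1) :* (con (+ 1) :* z :+ con (+ 1) :* x) :+ con (+ 1) :* (con (+ 1) :* y :+ con (+ 1) :* w)) :- z :- w :- y) refl (D u v) (D v u) (D u u) (D v v) ⟩
    fromℕ 1 * (fromℕ 1 * D u u + fromℕ 1 * D u v) + fromℕ 1 * (fromℕ 1 * D v u + fromℕ 1 * D v v) - D u u - D v v - D v u
                   ≈⟨ +-congʳ (+-cong (+-cong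
                        (trans (+-cong (*-congˡ (sym (linear₁ u))) (*-congˡ (sym (linear₁ v)))) (sym linear₀))
                        (-‿cong (equalRows u))) (-‿cong (equalRows v))) ⟩
    D s s - 0# - 0# - D v u ≈⟨ +-congʳ (+-congʳ (+-congʳ (equalRows s))) ⟩
    0# - 0# - 0# - D v u ≈⟨ solve 1 (λ x → con (+ 0) :- con (+ 0) :- con (+ 0) :- x := :- x) refl (D v u) ⟩
    - D v u ∎
    where
    D : (u v : Fin (suc (suc n)) → Carrier) → Carrier
    D u v = det (suc (suc n)) (topRows u v W)
    s : Fin (suc (suc n)) → Carrier
    s j = fromℕ 1 * u j + fromℕ 1 * v j
    equalRows : ∀ x → D x x ≈ 0#
    equalRows x = det-equal-top (topRows x x W) (λ _ → refl)
    linear₀ : D s s ≈ fromℕ 1 * D u s + fromℕ 1 * D v s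
    linear₀ = det-linear fzero {M = topRows s s W} {topRows u s W} {topRows v s W} (λ _ → refl)
      (λ { fzero i≢ → contradiction ≡.refl i≢ ; (fsuc fzero) _ _ → refl ; (fsuc (fsuc i)) _ _ → refl })
      (λ { fzero i≢ → contradiction ≡.refl i≢ ; (fsuc fzero) _ _ → refl ; (fsuc (fsuc i)) _ _ → refl })
    linear₁ : ∀ w → D w s ≈ fromℕ 1 * D w u + fromℕ 1 * D w v
    linear₁ w = det-linear (fsuc fzero) {M = topRows w s W} {topRows w u W} {topRows w v W} (λ _ → refl)
      (λ { fzero _ _ → refl ; (fsuc fzero) i≢ → contradiction ≡.refl i≢ ; (fsuc (fsuc i)) _ _ → refl })
      (λ { fzero _ _ → refl ; (fsuc fzero) i≢ → contradiction ≡.refl i≢ ; (fsuc (fsuc i)) _ _ → refl })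

  topRows-η : ∀ {n} (M : Matrix (suc (suc n))) i j →
    M i j ≈ topRows (M fzero) (M (fsuc fzero)) (λ k → M (fsuc (fsuc k))) i j
  topRows-η M fzero j = refl
  topRows-η M (fsuc fzero) j = refl
  topRows-η M (fsuc (fsuc i)) j = refl

  -- After one swap at the top, the equal pair lies within every minor of the expansion, its first
  -- member on top and the other one place nearer, so induction applies.
  det-equal : ∀ {n} (i : Fin n) (M : Matrix (suc n)) → (∀ j → M fzero j ≈ M (fsuc i) j) → det (suc n) M ≈ 0#
  det-equal fzero M eq = det-equal-top M eq
  det-equal {suc (suc n)} (fsuc i) M eq = begin
    det _ M       ≈⟨ det-cong (topRows-η M) ⟩
    det _ (topRows (M fzero) (M (fsuc fzero)) W) ≈⟨ det-swap-top (M fzero) (M (fsuc fzero)) W ⟩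
    - det _ M'    ≈⟨ -‿cong (sumFin-zero {f = term M'} λ j →
                       trans (*-congˡ (trans (*-congˡ (det-equal i (minor M' j) (λ k → eq (punchIn j k)))) (zeroʳ _))) (zeroʳ _)) ⟩
    - 0#          ≈⟨ -0#≈0# ⟩
    0#            ∎
    where
    W : Fin (suc n) → Fin (suc (suc (suc n))) → Carrier
    W k = M (fsuc (fsuc k))
    M' : Matrix (suc (suc (suc n)))
    M' = topRows (M (fsuc fzero)) (M fzero) W

  -- By linearity the change is k times a determinant in which the top row occurs twice.
  det-add-top : ∀ {n} (i : Fin n) (k : Carrier) {M A : Matrix (suc n)} →
    (∀ j → M (fsuc i) j ≈ A (fsuc i) j + k * A fzero j) →
    (∀ l → l ≢ fsuc i → ∀ j → M l j ≈ A l j) → det (suc n) M ≈ det (suc n) A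
  det-add-top {n} i k {M} {A} row same = begin
    det _ M                      ≈⟨ det-linear (fsuc i) {fromℕ 1} {k} {M} {A} {B}
                                      (λ j → trans (row j) (+-cong (trans (sym (*-identityˡ _)) (*-congʳ (sym (+-identityʳ 1#))))
                                                                   (*-congˡ (reflexive (≡.cong (λ r → r j) (≡.sym (updateAt-updates (fsuc i) A)))))))
                                      same
                                      (λ l l≢ j → trans (same l l≢ j) (reflexive (≡.cong (λ r → r j) (≡.sym (updateAt-minimal l (fsuc i) A l≢))))) ⟩
    fromℕ 1 * det _ A + k * det _ B ≈⟨ +-congˡ (*-congˡ (det-equal i B (λ j → reflexive (≡.cong (λ r → r j) (≡.sym (updateAt-updates (fsuc i) A)))))) ⟩
    fromℕ 1 * det _ A + k * 0#   ≈⟨ solve 2 (λ x k → con (+ 1) :* x :+ k :* con (+ 0) := x) refl (det _ A) k ⟩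
    det _ A                      ∎
    where
    B : Matrix (suc n)
    B = updateAt A (fsuc i) (const (A fzero))

  cons : ∀ {n m} → (Fin m → Carrier) → (Fin n → Fin m → Carrier) → Fin (suc n) → Fin m → Carrier
  cons v w fzero = v
  cons v w (fsuc i) = w i

  -- Clears the rows one at a time. `G` stands for the determinant as a function of the rows below
  -- the top; keeping it abstract lets the induction absorb the rows already treated into `G`.
  shear-invariant : ∀ {n m} (v : Fin m → Carrier) (G : (Fin n → Fin m → Carrier) → Carrier) →
    (∀ {w w'} → (∀ i j → w i j ≈ w' i j) → G w ≈ G w') →
    (∀ i k {w w'} → (∀ j → w i j ≈ w' i j + k * v j) → (∀ l → l ≢ i → ∀ j → w l j ≈ w' l j) → G w ≈ G w') →
    ∀ (k : Fin n → Carrier) w → G (λ i j → w i j + k i * v j) ≈ G w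
  shear-invariant {zero} v G G-cong G-shear k w = G-cong λ ()
  shear-invariant {suc n} {m} v G G-cong G-shear k w = begin
    G (λ i j → w i j + k i * v j)
      ≈⟨ G-shear fzero (k fzero) (λ _ → refl) (λ { fzero ne → λ _ → contradiction ≡.refl ne ; (fsuc i) _ _ → refl }) ⟩
    G (cons (w fzero) (λ i j → w (fsuc i) j + k (fsuc i) * v j))
      ≈⟨ shear-invariant v (G ∘ cons (w fzero))
           (λ eq → G-cong λ { fzero _ → refl ; (fsuc i) j → eq i j })
           (λ i k row same → G-shear (fsuc i) k row
             (λ { fzero _ _ → refl ; (fsuc l) ne → same l (λ { ≡.refl → ne ≡.refl }) }))
           (k ∘ fsuc) (w ∘ fsuc) ⟩
    G (cons (w fzero) (w ∘ fsuc))
      ≈⟨ G-cong (λ { fzero _ → refl ; (fsuc i) _ → refl }) ⟩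
    G w ∎

  det-zero-column : ∀ {n} {M : Matrix (suc n)} → (∀ i → M i fzero ≈ 0#) → det (suc n) M ≈ 0#
  det-zero-column {n} {M} M≈0 = sumFin-zero {f = term M} λ j → trans (*-congˡ {sgn (toℕ j)} (summand n M M≈0 j)) (zeroʳ _)
    where
    summand : ∀ n (M : Matrix (suc n)) → (∀ i → M i fzero ≈ 0#) → ∀ j → M fzero j * det n (minor M j) ≈ 0#
    summand n M M≈0 fzero = trans (*-congʳ (M≈0 fzero)) (zeroˡ _)
    summand (suc n) M M≈0 (fsuc j) = trans (*-congˡ (det-zero-column {M = minor M (fsuc j)} (λ i → M≈0 (fsuc i)))) (zeroʳ _)

  zeroColumn : ∀ {n m} → (Fin n → Fin m → Carrier) → Fin n → Fin (suc m) → Carrier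
  zeroColumn R i fzero = 0#
  zeroColumn R i (fsuc j) = R i j

  det-cons-zeroColumn : ∀ {n} (v : Fin (suc n) → Carrier) (R : Matrix n) →
    det (suc n) (cons v (zeroColumn R)) ≈ v fzero * det n R
  det-cons-zeroColumn {n} v R = begin
    1# * (v fzero * det n R) + sumFin n (λ j → term (cons v (zeroColumn R)) (fsuc j))
      ≈⟨ +-cong (*-identityˡ _) (sumFin-zero {f = λ j → term (cons v (zeroColumn R)) (fsuc j)}
           λ j → trans (*-congˡ (summand v R j)) (zeroʳ _)) ⟩
    v fzero * det n R + 0#     ≈⟨ +-identityʳ _ ⟩
    v fzero * det n R          ∎
    where
    summand : ∀ {n} (v : Fin (suc n) → Carrier) (R : Matrix n) j →
      v (fsuc j) * det n (minor (cons v (zeroColumn R)) (fsuc j)) ≈ 0#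
    summand {suc n} v R j = trans (*-congˡ (det-zero-column {M = minor (cons v (zeroColumn R)) (fsuc j)} λ _ → refl)) (zeroʳ _)

  -- One step of Gaussian elimination, with `R` as the Schur complement. The multipliers `k` are
  -- supplied rather than computed as quotients, so the pivot is never inverted.
  det-eliminate : ∀ {n} {M : Matrix (suc n)} {R : Matrix n} (k : Fin n → Carrier) →
    (∀ i → M (fsuc i) fzero ≈ k i * M fzero fzero) →
    (∀ i j → M (fsuc i) (fsuc j) ≈ k i * M fzero (fsuc j) + R i j) →
    det (suc n) M ≈ M fzero fzero * det n R
  det-eliminate {n} {M} {R} k column block = begin
    det (suc n) M                                     ≈⟨ det-cong sheared ⟩
    det (suc n) (cons (M fzero) (λ i j → zeroColumn R i j + k i * M fzero j))
      ≈⟨ shear-invariant (M fzero) (λ w → det (suc n) (cons (M fzero) w))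
           (λ {w} {w'} eq → det-cong {A = cons (M fzero) w} {cons (M fzero) w'} λ { fzero j → refl ; (fsuc i) j → eq i j })
           (λ i k {w} {w'} row same → det-add-top i k {cons (M fzero) w} {cons (M fzero) w'} row
             (λ { fzero _ _ → refl ; (fsuc l) ne → same l (λ { ≡.refl → ne ≡.refl }) }))
           k (zeroColumn R) ⟩
    det (suc n) (cons (M fzero) (zeroColumn R))       ≈⟨ det-cons-zeroColumn (M fzero) R ⟩
    M fzero fzero * det n R                           ∎
    where
    sheared : ∀ i j → M i j ≈ cons (M fzero) (λ i j → zeroColumn R i j + k i * M fzero j) i j
    sheared fzero j = refl
    sheared (fsuc i) fzero = trans (column i) (sym (+-identityˡ _))
    sheared (fsuc i) (fsuc j) = trans (block i j) (+-comm _ _)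

  -- Row reduction of Sylvester matrices

  -- Coefficients from the highest degree down; an N × N matrix reads only the
  -- first N of them.
  Row : Set c
  Row = ℕ → Carrier

  -- Rows past the end read as zero, which spares the concatenations below any bookkeeping of
  -- lengths.
  nth : List Row → ℕ → Row
  nth [] i = const 0#
  nth (r ∷ rs) zero = r
  nth (r ∷ rs) (suc i) = nth rs i

  rowMatrix : ∀ N → List Row → Matrix N
  rowMatrix N rs i j = nth rs (toℕ i) (toℕ j)

  detRows : ℕ → List Row → Carrier
  detRows N rs = det N (rowMatrix N rs)

  -- `r'` is what remains of `r` once a multiple of the pivot has cleared its head and the first
  -- column has been dropped.
  record Eliminates (pivot r r' : Row) : Set (c ⊔ ℓ) where
    constructor eliminates
    field
      factor : Carrier
      head≈  : r 0 ≈ factor * pivot 0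
      tail≈  : ∀ j → r (suc j) ≈ factor * pivot (suc j) + r' j

  Eliminates-nth : ∀ {v rs rs'} → Pointwise (Eliminates v) rs rs' → ∀ i → Eliminates v (nth rs i) (nth rs' i)
  Eliminates-nth [] i = eliminates 0# (sym (zeroˡ _)) (λ j → sym (trans (+-identityʳ _) (zeroˡ _)))
  Eliminates-nth (r ∷ rs) zero = r
  Eliminates-nth (r ∷ rs) (suc i) = Eliminates-nth rs i

  detRows-eliminate : ∀ N v {rs rs'} → Pointwise (Eliminates v) rs rs' →
    detRows (suc N) (v ∷ rs) ≈ v 0 * detRows N rs'
  detRows-eliminate N v {rs} {rs'} elim =
    det-eliminate {M = rowMatrix (suc N) (v ∷ rs)} {rowMatrix N rs'}
      (λ i → Eliminates.factor (Eliminates-nth elim (toℕ i)))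
      (λ i → Eliminates.head≈ (Eliminates-nth elim (toℕ i)))
      (λ i j → Eliminates.tail≈ (Eliminates-nth elim (toℕ i)) (toℕ j))

  detRows-swap : ∀ N u v rs → detRows (suc (suc N)) (u ∷ v ∷ rs) ≈ - detRows (suc (suc N)) (v ∷ u ∷ rs)
  detRows-swap N u v rs = begin
    detRows (suc (suc N)) (u ∷ v ∷ rs)             ≈⟨ det-cong (topRows-η (rowMatrix (suc (suc N)) (u ∷ v ∷ rs))) ⟩
    det (suc (suc N)) (topRows (u ∘ toℕ) (v ∘ toℕ) W)  ≈⟨ det-swap-top (u ∘ toℕ) (v ∘ toℕ) W ⟩
    - det (suc (suc N)) (topRows (v ∘ toℕ) (u ∘ toℕ) W) ≈⟨ -‿cong (sym (det-cong (topRows-η (rowMatrix (suc (suc N)) (v ∷ u ∷ rs))))) ⟩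
    - detRows (suc (suc N)) (v ∷ u ∷ rs)           ∎
    where
    W : Fin N → Fin (suc (suc N)) → Carrier
    W i j = nth rs (toℕ i) (toℕ j)

  detRows-scale : ∀ N α {u v} rs → (∀ j → u j ≈ α * v j) → detRows (suc N) (u ∷ rs) ≈ α * detRows (suc N) (v ∷ rs)
  detRows-scale N α {u} {v} rs u≈αv = trans
    (sumFin-cong {f = term (rowMatrix (suc N) (u ∷ rs))} {λ j → α * term (rowMatrix (suc N) (v ∷ rs)) j} λ j →
      trans (*-congˡ (*-congʳ (u≈αv (toℕ j))))
        (solve 4 (λ s α x d → s :* ((α :* x) :* d) := α :* (s :* (x :* d))) refl (sgn (toℕ j)) α (v (toℕ j))
          (det N (minor (rowMatrix (suc N) (u ∷ rs)) j))))
    (sym (sumFin-*ˡ α (term (rowMatrix (suc N) (v ∷ rs)))))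

  infixr 5 _▹_

  _▹_ : Carrier → Row → Row
  (x ▹ v) zero = x
  (x ▹ v) (suc j) = v j

  shift : ℕ → Row → Row
  shift zero v = v
  shift (suc r) v = 0# ▹ shift r v

  shifts : (m i : ℕ) → Row → List Row
  shifts zero i v = []
  shifts (suc m) i v = shift i v ∷ shifts m (suc i) v

  shift-linear : ∀ r {k u v w} → (∀ j → u j ≈ k * v j + w j) → ∀ j → shift r u j ≈ k * shift r v j + shift r w j
  shift-linear zero eq j = eq j
  shift-linear (suc r) eq zero = sym (trans (+-identityʳ _) (zeroʳ _))
  shift-linear (suc r) eq (suc j) = shift-linear r eq j

  -- A newly reduced row arrives behind the shifts of `g` already present; this adds it to their
  -- run.
  shifts-snoc : ∀ m i v rs → shifts (suc m) i v ++ rs ≡ shifts m i v ++ shift (i ℕ.+ m) v ∷ rs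
  shifts-snoc zero i v rs = ≡.cong (λ k → shift k v ∷ rs) (≡.sym (ℕₚ.+-identityʳ i))
  shifts-snoc (suc m) i v rs = ≡.cong (shift i v ∷_)
    (≡.trans (shifts-snoc m (suc i) v rs) (≡.cong (λ k → shifts m (suc i) v ++ shift k v ∷ rs) (≡.sym (ℕₚ.+-suc i m))))

  -- A row with head zero is left alone by the pivot and merely moves one column to the left.
  Eliminates-padded : ∀ {v r} → Eliminates v (0# ▹ r) r
  Eliminates-padded = eliminates 0# (sym (zeroˡ _)) (λ j → sym (trans (+-congʳ (zeroˡ _)) (+-identityˡ _)))

  Eliminates-shifts : ∀ {v} m i r → Pointwise (Eliminates v) (shifts m (suc i) r) (shifts m i r)
  Eliminates-shifts zero i r = []
  Eliminates-shifts (suc m) i r = Eliminates-padded ∷ Eliminates-shifts m (suc i) r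

  module SylvesterElimination (p : ℕ) (f f' g : Row) (monic : f 0 ≈ 1#) (f-eliminates : Eliminates f f' (shift p g)) where

    -- The i + 1 untouched rows of f, the j rows of f' already reduced to
    -- shifts of g by a row of f, and the i + 2 untouched rows of f'.
    stage : ℕ → ℕ → List Row
    stage i j = shifts (suc i) 0 f ++ shifts j i g ++ shifts (suc (suc i)) 0 f'

    -- Below the pivot only the first row of `f'` has a nonzero head. It becomes `shift p g`, and i
    -- + j = p is exactly the condition for it to continue the run of shifts of `g`.
    stage-step : ∀ N i j → i ℕ.+ j ≡ p → detRows (suc N) (stage (suc i) j) ≈ detRows N (stage i (suc j))
    stage-step N i j i+j≡p = begin
      detRows (suc N) (stage (suc i) j)
        ≈⟨ detRows-eliminate N f (++⁺ (Eliminates-shifts (suc i) 0 f) (++⁺ (Eliminates-shifts j i g)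
             (f-eliminates ∷ Eliminates-shifts (suc (suc i)) 0 f'))) ⟩
      f 0 * detRows N (shifts (suc i) 0 f ++ shifts j i g ++ shift p g ∷ shifts (suc (suc i)) 0 f')
        ≈⟨ trans (*-congʳ monic) (*-identityˡ _) ⟩
      detRows N (shifts (suc i) 0 f ++ shifts j i g ++ shift p g ∷ shifts (suc (suc i)) 0 f')
        ≈⟨ reflexive (≡.cong (λ rs → detRows N (shifts (suc i) 0 f ++ rs))
             (≡.trans (≡.cong (λ k → shifts j i g ++ shift k g ∷ shifts (suc (suc i)) 0 f') (≡.sym i+j≡p))
                      (≡.sym (shifts-snoc j i g _)))) ⟩
      detRows N (stage i (suc j)) ∎

    stage-steps : ∀ N i j → i ℕ.+ j ≡ suc p → detRows (i ℕ.+ N) (stage i j) ≈ detRows N (stage 0 (suc p))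
    stage-steps N zero j ≡.refl = refl
    stage-steps N (suc i) j i+j≡ = trans
      (stage-step (i ℕ.+ N) i j (ℕₚ.suc-injective i+j≡))
      (stage-steps N i (suc j) (≡.trans (ℕₚ.+-suc i j) i+j≡))

    -- A monomial multiple of g minus g₀ f, where g₀ is the leading coefficient of g. Modulo g it is
    -- - g₀ f, so it preserves the remainder of f after the last row of f is used up.
    g* : Row
    g* j = g (suc j) - g 0 * f (suc j)

    -- In the last stage the first row of `g` is unshifted, so its head must be cleared as well;
    -- this produces `g*`. One row of `f'` survives because there is one more of them than of `f`.
    last-step : ∀ N → detRows (suc N) (stage 0 (suc p)) ≈ detRows N (g* ∷ shifts (suc p) 0 g ++ f' ∷ [])
    last-step N = begin
      detRows (suc N) (stage 0 (suc p))
        ≈⟨ detRows-eliminate N f (eliminates (g 0) (sym (trans (*-congˡ monic) (*-identityʳ _)))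
             (λ j → solve 2 (λ x y → x := y :+ (x :- y)) refl (g (suc j)) (g 0 * f (suc j))) ∷
             ++⁺ (Eliminates-shifts p 0 g) (f-eliminates ∷ Eliminates-padded ∷ [])) ⟩
      f 0 * detRows N (g* ∷ shifts p 0 g ++ shift p g ∷ f' ∷ [])
        ≈⟨ trans (*-congʳ monic) (*-identityˡ _) ⟩
      detRows N (g* ∷ shifts p 0 g ++ shift p g ∷ f' ∷ [])
        ≈⟨ reflexive (≡.cong (λ rs → detRows N (g* ∷ rs)) (≡.sym (shifts-snoc p 0 g (f' ∷ [])))) ⟩
      detRows N (g* ∷ shifts (suc p) 0 g ++ f' ∷ []) ∎

    detRows-sylvester : ∀ N → detRows (suc p ℕ.+ suc N) (shifts (suc (suc p)) 0 f ++ shifts (suc (suc (suc p))) 0 f')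
      ≈ detRows N (g* ∷ shifts (suc p) 0 g ++ f' ∷ [])
    detRows-sylvester N = trans (stage-steps (suc N) (suc p) 0 (ℕₚ.+-identityʳ (suc p))) (last-step N)

  -- evaluate x N v is the image of the polynomial v₀ X^(N-1) + … + v_(N-1)
  -- under the linear map X^k ↦ x k.
  evaluate : Row → ℕ → Row → Carrier
  evaluate x zero v = 0#
  evaluate x (suc N) v = v 0 * x N + evaluate x N (v ∘ suc)

  evaluate-zero : ∀ x N → evaluate x N (const 0#) ≈ 0#
  evaluate-zero x zero = refl
  evaluate-zero x (suc N) = trans (+-cong (zeroˡ _) (evaluate-zero x N)) (+-identityˡ 0#)

  evaluate-sub : ∀ x N k u v → evaluate x N (λ j → u j - k * v j) ≈ evaluate x N u - k * evaluate x N v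
  evaluate-sub x zero k u v = solve 1 (λ k → con (+ 0) := con (+ 0) :- k :* con (+ 0)) refl k
  evaluate-sub x (suc N) k u v = trans (+-congˡ (evaluate-sub x N k (u ∘ suc) (v ∘ suc)))
    (solve 6 (λ k a b y U V → (a :- k :* b) :* y :+ (U :- k :* V) := a :* y :+ U :- k :* (b :* y :+ V)) refl
      k (u 0) (v 0) (x N) (evaluate x N (u ∘ suc)) (evaluate x N (v ∘ suc)))

  evaluate-scale : ∀ x N {k u v} → (∀ j → u j ≈ k * v j) → evaluate x N u ≈ k * evaluate x N v
  evaluate-scale x zero eq = sym (zeroʳ _)
  evaluate-scale x (suc N) {k} {u} {v} eq = trans (+-cong (*-congʳ (eq 0)) (evaluate-scale x N (eq ∘ suc)))
    (solve 4 (λ k a y U → k :* a :* y :+ k :* U := k :* (a :* y :+ U)) refl k (v 0) (x N) (evaluate x N (v ∘ suc)))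

  evaluate-shift : ∀ x r N v → evaluate x (r ℕ.+ N) (shift r v) ≈ evaluate x N v
  evaluate-shift x zero N v = refl
  evaluate-shift x (suc r) N v = trans (+-cong (zeroˡ _) (evaluate-shift x r N v)) (+-identityˡ _)

  -- X^k ≡ u k X + w k modulo the monic quadratic X² + σ X + ε.
  module Quadratic (σ ε : Carrier) where

    u w : ℕ → Carrier
    u zero = 0#
    u (suc k) = w k - σ * u k
    w zero = 1#
    w (suc k) = - (ε * u k)

    -- Characterizes the functionals X^k ↦ `x k` that vanish on all multiples of the quadratic,
    -- hence depend only on remainders.
    Recurrent : Row → Set ℓ
    Recurrent x = ∀ k → x (suc (suc k)) ≈ - (σ * x (suc k) + ε * x k)

    u-recurrent : Recurrent u
    u-recurrent k = solve 4 (λ σ ε x y → :- (ε :* x) :- σ :* y := :- (σ :* y :+ ε :* x)) refl σ ε (u k) (u (suc k))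

    w-recurrent : Recurrent w
    w-recurrent k = solve 4 (λ σ ε x y → :- (ε :* (y :- σ :* x)) := :- (σ :* (:- (ε :* x)) :+ ε :* y)) refl σ ε (u k) (w k)

    -- The left side is the norm of u X + w. Multiplying by X multiplies the norm by ε, the norm of
    -- X.
    norm : ∀ k → w k * w k - σ * u k * w k + ε * (u k * u k) ≈ ε ^ k
    norm zero = solve 2 (λ σ ε → :1 :* :1 :- σ :* con (+ 0) :* :1 :+ ε :* (con (+ 0) :* con (+ 0)) := :1) refl σ ε
    norm (suc k) = trans
      (solve 4 (λ σ ε y z →
          (:- (ε :* y)) :* (:- (ε :* y)) :- σ :* (z :- σ :* y) :* (:- (ε :* y)) :+ ε :* ((z :- σ :* y) :* (z :- σ :* y))
          := ε :* (z :* z :- σ :* y :* z :+ ε :* (y :* y))) refl σ ε (u k) (w k))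
      (*-congˡ (norm k))

  -- The scalar `α`, later - t, is kept apart from the quadratic so that only `a₂` has to be
  -- invertible.
  module QuadraticElimination (α a₂ a₁ a₀ a₂⁻¹ : Carrier) (unit : a₂⁻¹ * a₂ ≈ 1#) (g : Row)
    (g≈ : ∀ j → g j ≈ α * (a₂ ▹ a₁ ▹ a₀ ▹ const 0#) j) where

    open Quadratic (a₂⁻¹ * a₁) (a₂⁻¹ * a₀)

    q : Row
    q = a₂ ▹ a₁ ▹ a₀ ▹ const 0#

    reduce : Row → Row
    reduce v j = v (suc j) - v 0 * a₂⁻¹ * q (suc j)

    Eliminates-reduce : ∀ v → Eliminates q v (reduce v)
    Eliminates-reduce v = eliminates (v 0 * a₂⁻¹)
      (sym (trans (*-assoc _ _ _) (trans (*-congˡ unit) (*-identityʳ _))))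
      (λ j → solve 2 (λ x y → x := y :+ (x :- y)) refl (v (suc j)) (v 0 * a₂⁻¹ * q (suc j)))

    -- `reduce` subtracts a monomial multiple of `q`, on which a recurrent functional vanishes.
    evaluate-reduce : ∀ {x} → Recurrent x → ∀ m v →
      evaluate x (suc (suc m)) (reduce v) ≈ evaluate x (suc (suc (suc m))) v
    evaluate-reduce {x} rec m v = begin
      evaluate x (suc (suc m)) (reduce v)
        ≈⟨ evaluate-sub x (suc (suc m)) (v 0 * a₂⁻¹) (v ∘ suc) (q ∘ suc) ⟩
      tail - v 0 * a₂⁻¹ * (a₁ * x (suc m) + (a₀ * x m + evaluate x m (const 0#)))
        ≈⟨ +-congˡ (-‿cong (*-congˡ (+-congˡ (+-congˡ (evaluate-zero x m))))) ⟩
      tail - v 0 * a₂⁻¹ * (a₁ * x (suc m) + (a₀ * x m + 0#))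
        ≈⟨ solve 7 (λ T v i a b y z → T :- v :* i :* (a :* y :+ (b :* z :+ con (+ 0)))
                                   := v :* (:- (i :* a :* y :+ i :* b :* z)) :+ T) refl
             tail (v 0) a₂⁻¹ a₁ a₀ (x (suc m)) (x m) ⟩
      v 0 * - (a₂⁻¹ * a₁ * x (suc m) + a₂⁻¹ * a₀ * x m) + tail
        ≈⟨ +-congʳ (*-congˡ (sym (rec m))) ⟩
      v 0 * x (suc (suc m)) + tail ∎
      where
      tail : Carrier
      tail = evaluate x (suc (suc m)) (v ∘ suc)

    -- Only the remainders of v and h modulo q matter, and evaluate u, evaluate w
    -- are the coordinates of the remainder.
    detRows-quadratic : ∀ m v h → detRows (suc (suc m)) (v ∷ shifts m 0 g ++ h ∷ []) ≈
      (- (α * a₂)) ^ m * (evaluate u (suc (suc m)) v * evaluate w (suc (suc m)) h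
                        - evaluate w (suc (suc m)) v * evaluate u (suc (suc m)) h)
    detRows-quadratic zero v h = solve 6 (λ σ ε v₀ v₁ h₀ h₁ →
        let u₁ = :1 :- σ :* con (+ 0) ; w₁ = :- (ε :* con (+ 0)) in
        :1 :* (v₀ :* (:1 :* (h₁ :* :1) :+ con (+ 0))) :+ ((:- :1 :* :1) :* (v₁ :* (:1 :* (h₀ :* :1) :+ con (+ 0))) :+ con (+ 0))
        := :1 :* ((v₀ :* u₁ :+ (v₁ :* con (+ 0) :+ con (+ 0))) :* (h₀ :* w₁ :+ (h₁ :* :1 :+ con (+ 0)))
               :- (v₀ :* w₁ :+ (v₁ :* :1 :+ con (+ 0))) :* (h₀ :* u₁ :+ (h₁ :* con (+ 0) :+ con (+ 0))))) refl
      (a₂⁻¹ * a₁) (a₂⁻¹ * a₀) (v 0) (v 1) (h 0) (h 1)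
    detRows-quadratic (suc m) v h = begin
      -- The swap makes the first row of `g` the pivot. Its sign, the scalar `α` and the pivot `a₂`
      -- account for one factor - (α a₂).
      detRows N (v ∷ g ∷ shifts m 1 g ++ h ∷ [])        ≈⟨ detRows-swap (suc m) v g (shifts m 1 g ++ h ∷ []) ⟩
      - detRows N (g ∷ v ∷ shifts m 1 g ++ h ∷ [])      ≈⟨ -‿cong (detRows-scale (suc (suc m)) α {g} {q} (v ∷ shifts m 1 g ++ h ∷ []) g≈) ⟩
      - (α * detRows N (q ∷ v ∷ shifts m 1 g ++ h ∷ []))
        ≈⟨ -‿cong (*-congˡ (detRows-eliminate (suc (suc m)) q (Eliminates-reduce v ∷
             ++⁺ (Eliminates-shifts m 0 g) (Eliminates-reduce h ∷ [])))) ⟩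
      - (α * (a₂ * detRows (suc (suc m)) (reduce v ∷ shifts m 0 g ++ reduce h ∷ [])))
        ≈⟨ -‿cong (*-congˡ (*-congˡ (detRows-quadratic m (reduce v) (reduce h)))) ⟩
      - (α * (a₂ * ((- (α * a₂)) ^ m * (⟪ u , v ⟫ * ⟪ w , h ⟫
                                      - ⟪ w , v ⟫ * ⟪ u , h ⟫))))
        ≈⟨ solve 4 (λ α a p d → :- (α :* (a :* (p :* d))) := :- (α :* a) :* p :* d) refl α a₂ _
             (⟪ u , v ⟫ * ⟪ w , h ⟫ - ⟪ w , v ⟫ * ⟪ u , h ⟫) ⟩
      (- (α * a₂)) ^ suc m * (⟪ u , v ⟫ * ⟪ w , h ⟫
                            - ⟪ w , v ⟫ * ⟪ u , h ⟫)
        ≈⟨ *-congˡ (+-cong (*-cong (evaluate-reduce u-recurrent m v) (evaluate-reduce w-recurrent m h))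
             (-‿cong (*-cong (evaluate-reduce w-recurrent m v) (evaluate-reduce u-recurrent m h)))) ⟩
      (- (α * a₂)) ^ suc m * (evaluate u N v * evaluate w N h - evaluate w N v * evaluate u N h) ∎
      where
      N : ℕ
      N = suc (suc (suc m))
      ⟪_,_⟫ : Row → Row → Carrier
      ⟪ x , r ⟫ = evaluate x (suc (suc m)) (reduce r)

  -- The resultant of f and its derivative

  leading : ℕ → (ℕ → Carrier) → Row
  leading d P j = if j ≤ᵇ d then P (d ∸ j) else 0#

  -- The right side is the entry formula of `sylvester`, so the two descriptions of the matrix agree
  -- by rewriting.
  shift-leading : ∀ d P r j →
    shift r (leading d P) j ≡ (if (r ≤ᵇ j) ∧ (j ≤ᵇ r ℕ.+ d) then P ((d ℕ.+ r) ∸ j) else 0#)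
  shift-leading d P zero j rewrite ℕₚ.+-identityʳ d = ≡.refl
  shift-leading d P (suc r) zero = ≡.refl
  shift-leading d P (suc r) (suc j)
    rewrite ≤ᵇ-suc r j | ≤ᵇ-suc j (r ℕ.+ d) | ℕₚ.+-suc d r = shift-leading d P r j

  nth-shifts : ∀ m k v i j → i ℕ.< m → nth (shifts m k v) i j ≡ shift (k ℕ.+ i) v j
  nth-shifts (suc m) k v zero j _ = ≡.cong (λ r → shift r v j) (≡.sym (ℕₚ.+-identityʳ k))
  nth-shifts (suc m) k v (suc i) j (s≤s i<m) =
    ≡.trans (nth-shifts m (suc k) v i j i<m) (≡.cong (λ r → shift r v j) (≡.sym (ℕₚ.+-suc k i)))

  nth-shifts-++ : ∀ m k v rs i j →
    nth (shifts m k v ++ rs) i j ≡ (if i <ᵇ m then shift (k ℕ.+ i) v j else nth rs (i ∸ m) j)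
  nth-shifts-++ zero k v rs i j = ≡.refl
  nth-shifts-++ (suc m) k v rs zero j = ≡.cong (λ r → shift r v j) (≡.sym (ℕₚ.+-identityʳ k))
  nth-shifts-++ (suc m) k v rs (suc i) j rewrite ℕₚ.+-suc k i = nth-shifts-++ m (suc k) v rs i j

  sylvester-rows : ∀ d P e Q .{{_ : ℕ.NonZero d}} i j →
    sylvester d P e Q i j ≡ nth (shifts e 0 (leading d P) ++ shifts d 0 (leading e Q)) (toℕ i) (toℕ j)
  sylvester-rows d P e Q i j
    rewrite nth-shifts-++ e 0 (leading d P) (shifts d 0 (leading e Q)) (toℕ i) (toℕ j)
          | shift-leading d P (toℕ i) (toℕ j)
          | nth-shifts d 0 (leading e Q) (toℕ i ∸ e) (toℕ j) (ℕₚ.m<n+o⇒m∸n<o (toℕ i) e (toℕ<n i))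
          | shift-leading e Q (toℕ i ∸ e) (toℕ j) = ≡.refl

  leading-suc : ∀ d P j → leading (suc d) P (suc j) ≡ leading d P j
  leading-suc d P j rewrite ≤ᵇ-suc j d = ≡.refl

  leading-zeros : ∀ p m P → (∀ k → k ℕ.< p → P (m ℕ.+ suc k) ≈ 0#) → ∀ j → leading (m ℕ.+ p) P j ≈ shift p (leading m P) j
  leading-zeros zero m P P≈0 j = reflexive (≡.cong (λ d → leading d P j) (ℕₚ.+-identityʳ m))
  leading-zeros (suc p) m P P≈0 zero = P≈0 p ℕₚ.≤-refl
  leading-zeros (suc p) m P P≈0 (suc j) = trans
    (reflexive (≡.trans (≡.cong (λ d → leading d P (suc j)) (ℕₚ.+-suc m p)) (leading-suc (m ℕ.+ p) P j)))
    (leading-zeros p m P (λ k k<p → P≈0 k (ℕₚ.m<n⇒m<1+n k<p)) j)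

  shift-cong : ∀ r {u v} → (∀ j → u j ≈ v j) → ∀ j → shift r u j ≈ shift r v j
  shift-cong zero eq j = eq j
  shift-cong (suc r) eq zero = refl
  shift-cong (suc r) eq (suc j) = shift-cong r eq j

  evaluate-cong : ∀ x N {u v} → (∀ j → u j ≈ v j) → evaluate x N u ≈ evaluate x N v
  evaluate-cong x zero eq = refl
  evaluate-cong x (suc N) eq = +-cong (*-congʳ (eq 0)) (evaluate-cong x N (eq ∘ suc))

  ^-cong : ∀ {x y} k → x ≈ y → x ^ k ≈ y ^ k
  ^-cong zero x≈y = refl
  ^-cong (suc k) x≈y = *-cong x≈y (^-cong k x≈y)

  ^-* : ∀ x y k → (x * y) ^ k ≈ x ^ k * y ^ k
  ^-* x y zero = sym (*-identityˡ 1#)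
  ^-* x y (suc k) = trans (*-congˡ (^-* x y k))
    (solve 4 (λ x y X Y → x :* y :* (X :* Y) := x :* X :* (y :* Y)) refl x y (x ^ k) (y ^ k))

  sgn-+ : ∀ j k → sgn (j ℕ.+ k) ≈ sgn j * sgn k
  sgn-+ zero k = sym (*-identityˡ _)
  sgn-+ (suc j) k = trans (*-congˡ (sgn-+ j k)) (sym (*-assoc _ _ _))

  sgn-double : ∀ k → sgn (k ℕ.+ k) ≈ 1#
  sgn-double zero = refl
  sgn-double (suc k) = trans (reflexive (≡.cong (sgn ∘ suc) (ℕₚ.+-suc k k)))
    (trans (solve 1 (λ x → :- :1 :* (:- :1 :* x) := x) refl (sgn (k ℕ.+ k))) (sgn-double k))

  [≡ᵇ]-refl : ∀ k → [ k ≡ᵇ k ] ≈ 1#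
  [≡ᵇ]-refl zero = refl
  [≡ᵇ]-refl (suc k) = [≡ᵇ]-refl k

  [≡ᵇ]-< : ∀ {k m} → k ℕ.< m → [ k ≡ᵇ m ] ≈ 0#
  [≡ᵇ]-< {zero} {suc m} _ = refl
  [≡ᵇ]-< {suc k} {suc m} (s≤s k<m) = [≡ᵇ]-< k<m

  1⁻¹≈1 : 1# ⁻¹ ≈ 1#
  1⁻¹≈1 = trans (sym (*-identityˡ _)) (⁻¹-inverse 1# λ 1≈0 → char0 0 (trans (+-identityʳ 1#) 1≈0))

  lucas : Carrier → Carrier → ℕ → Carrier
  lucas x y zero = 1#
  lucas x y (suc zero) = x
  lucas x y (suc (suc k)) = x * lucas x y (suc k) + y * lucas x y k

  module Trinomial (p : ℕ) (a b t : Carrier) where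

    n : ℕ
    n = suc (suc (suc p))

    N N₁ N₂ : Carrier
    N = fromℕ n
    N₁ = fromℕ (suc (suc p))
    N₂ = fromℕ (suc p)

    P f f' : ℕ → Carrier
    P = fc n a b t
    f = leading n P
    f' = leading (suc (suc p)) (deriv P)

    P-leading : P n ≈ 1#
    P-leading = trans (+-congʳ ([≡ᵇ]-refl p))
      (solve 3 (λ a b t → :1 :+ t :* (con (+ 0) :+ a :* con (+ 0) :+ b :* con (+ 0)) := :1) refl a b t)

    P-gap : ∀ k → k ℕ.< p → P (suc (suc (suc k))) ≈ 0#
    P-gap k k<p = trans (+-congʳ ([≡ᵇ]-< k<p))
      (solve 3 (λ a b t → con (+ 0) :+ t :* (con (+ 0) :+ a :* con (+ 0) :+ b :* con (+ 0)) := con (+ 0)) refl a b t)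

    f-tail : ∀ j → f (suc j) ≈ shift p (t ▹ t * a ▹ t * b ▹ const 0#) j
    f-tail j = trans (reflexive (leading-suc (suc (suc p)) P j)) (trans (leading-zeros p 2 P P-gap j) (shift-cong p low j))
      where
      low : ∀ j → leading 2 P j ≈ (t ▹ t * a ▹ t * b ▹ const 0#) j
      low 0 = solve 3 (λ a b t → con (+ 0) :+ t :* (:1 :+ a :* con (+ 0) :+ b :* con (+ 0)) := t) refl a b t
      low 1 = solve 3 (λ a b t → con (+ 0) :+ t :* (con (+ 0) :+ a :* :1 :+ b :* con (+ 0)) := t :* a) refl a b t
      low 2 = solve 3 (λ a b t → con (+ 0) :+ t :* (con (+ 0) :+ a :* con (+ 0) :+ b :* :1) := t :* b) refl a b t
      low (suc (suc (suc j))) = refl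

    f'-tail : ∀ j → f' (suc j) ≈ shift p (fromℕ 2 * t ▹ t * a ▹ const 0#) j
    f'-tail j = trans (reflexive (leading-suc (suc p) (deriv P) j))
      (trans (leading-zeros p 1 (deriv P) (λ k k<p → trans (*-congˡ (P-gap k k<p)) (zeroʳ _)) j) (shift-cong p low j))
      where
      low : ∀ j → leading 1 (deriv P) j ≈ (fromℕ 2 * t ▹ t * a ▹ const 0#) j
      low 0 = solve 3 (λ a b t → con (+ 2) :* (con (+ 0) :+ t :* (:1 :+ a :* con (+ 0) :+ b :* con (+ 0))) := con (+ 2) :* t) refl a b t
      low 1 = solve 3 (λ a b t → con (+ 1) :* (con (+ 0) :+ t :* (con (+ 0) :+ a :* :1 :+ b :* con (+ 0))) := t :* a) refl a b t
      low (suc (suc j)) = refl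

    q : Row
    q = N₂ ▹ N₁ * a ▹ N * b ▹ const 0#

    g : Row
    g j = - t * q j

    -- This encodes n f - x f' = t q.
    f-eliminates : Eliminates f f' (shift p g)
    f-eliminates = eliminates N (*-congˡ refl) λ j → trans (f'-tail j)
        (trans (shift-linear p euler j) (+-congʳ (*-congˡ (sym (f-tail j)))))
      where
      euler : ∀ j → (fromℕ 2 * t ▹ t * a ▹ const 0#) j ≈ N * (t ▹ t * a ▹ t * b ▹ const 0#) j + g j
      euler 0 = solve 2 (λ n t → con (+ 2) :* t := (:1 :+ (:1 :+ n)) :* t :+ :- t :* n) refl N₂ t
      euler 1 = solve 3 (λ n a t → t :* a := (:1 :+ n) :* (t :* a) :+ :- t :* (n :* a)) refl N₁ a t
      euler 2 = solve 3 (λ n b t → con (+ 0) := n :* (t :* b) :+ :- t :* (n :* b)) refl N b t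
      euler (suc (suc (suc j))) = solve 2 (λ n t → con (+ 0) := n :* con (+ 0) :+ :- t :* con (+ 0)) refl N t

    N₂-unit : N₂ ⁻¹ * N₂ ≈ 1#
    N₂-unit = trans (*-comm _ _) (⁻¹-inverse N₂ (char0 p))

    σ ε : Carrier
    σ = N₂ ⁻¹ * (N₁ * a)
    ε = N₂ ⁻¹ * (N * b)

    N₂σ : N₂ * σ ≈ N₁ * a
    N₂σ = trans (sym (*-assoc _ _ _)) (trans (*-congʳ (trans (*-comm _ _) N₂-unit)) (*-identityˡ _))

    N₂ε : N₂ * ε ≈ N * b
    N₂ε = trans (sym (*-assoc _ _ _)) (trans (*-congʳ (trans (*-comm _ _) N₂-unit)) (*-identityˡ _))

    open Quadratic σ ε
    open SylvesterElimination p f f' g P-leading f-eliminates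
    open QuadraticElimination (- t) N₂ (N₁ * a) (N * b) (N₂ ⁻¹) N₂-unit g (λ _ → refl) hiding (q)

    evaluate-f' : ∀ x → evaluate x n f' ≈ N * x (suc (suc p)) + (fromℕ 2 * t * x 1 + t * a * x 0)
    evaluate-f' x = +-cong (*-congʳ (trans (*-congˡ P-leading) (*-identityʳ N))) (begin
      evaluate x (suc (suc p)) (f' ∘ suc)                                        ≈⟨ evaluate-cong x (suc (suc p)) f'-tail ⟩
      evaluate x (suc (suc p)) (shift p (fromℕ 2 * t ▹ t * a ▹ const 0#))
        ≈⟨ reflexive (≡.cong (λ m → evaluate x m (shift p (fromℕ 2 * t ▹ t * a ▹ const 0#))) (ℕₚ.+-comm 2 p)) ⟩
      evaluate x (p ℕ.+ 2) (shift p (fromℕ 2 * t ▹ t * a ▹ const 0#))            ≈⟨ evaluate-shift x p 2 _ ⟩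
      fromℕ 2 * t * x 1 + (t * a * x 0 + 0#)                                     ≈⟨ +-congˡ (+-identityʳ _) ⟩
      fromℕ 2 * t * x 1 + t * a * x 0                                            ∎)

    -- Modulo q the row `g*` is - g₀ f with - g₀ = t (n - 2), so its value is t (n - 2) times that
    -- of f.
    evaluate-g* : ∀ {x} → Recurrent x →
      evaluate x n g* ≈ t * N₂ * (x n + (t * x 2 + (t * a * x 1 + t * b * x 0)))
    evaluate-g* {x} rec = begin
      evaluate x n g*
        ≈⟨ evaluate-sub x n (g 0) (g ∘ suc) (f ∘ suc) ⟩
      evaluate x n (g ∘ suc) - g 0 * evaluate x n (f ∘ suc)
        ≈⟨ +-cong (evaluate-scale x n {k = - t} {v = q ∘ suc} (λ _ → refl)) (-‿cong (*-congˡ f-part)) ⟩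
      - t * (N₁ * a * x₂ + (N * b * x₁ + evaluate x (suc p) (const 0#))) - g 0 * low
        ≈⟨ +-congʳ (*-congˡ (+-cong (*-congʳ (sym N₂σ)) (+-cong (*-congʳ (sym N₂ε)) (evaluate-zero x (suc p))))) ⟩
      - t * (N₂ * σ * x₂ + (N₂ * ε * x₁ + 0#)) - - t * N₂ * low
        ≈⟨ solve 7 (λ t n σ ε x₂ x₁ l → :- t :* (n :* σ :* x₂ :+ (n :* ε :* x₁ :+ con (+ 0))) :- :- t :* n :* l
              := t :* n :* (:- (σ :* x₂ :+ ε :* x₁) :+ l)) refl t N₂ σ ε x₂ x₁ low ⟩
      t * N₂ * (- (σ * x₂ + ε * x₁) + low)
        -- The recurrence restores the leading term X^n of f from the two lower coefficients of q.
        ≈⟨ *-congˡ (+-congʳ (sym (rec (suc p)))) ⟩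
      t * N₂ * (x n + low) ∎
      where
      x₁ x₂ low : Carrier
      x₁ = x (suc p)
      x₂ = x (suc (suc p))
      low = t * x 2 + (t * a * x 1 + t * b * x 0)
      f-part : evaluate x n (f ∘ suc) ≈ low
      f-part = begin
        evaluate x n (f ∘ suc)                                            ≈⟨ evaluate-cong x n f-tail ⟩
        evaluate x n (shift p (t ▹ t * a ▹ t * b ▹ const 0#))
          ≈⟨ reflexive (≡.cong (λ m → evaluate x m (shift p (t ▹ t * a ▹ t * b ▹ const 0#))) (ℕₚ.+-comm 3 p)) ⟩
        evaluate x (p ℕ.+ 3) (shift p (t ▹ t * a ▹ t * b ▹ const 0#))     ≈⟨ evaluate-shift x p 3 _ ⟩
        t * x 2 + (t * a * x 1 + (t * b * x 0 + 0#))                      ≈⟨ +-congˡ (+-congˡ (+-identityʳ _)) ⟩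
        low                                                               ∎

    -- The 2 × 2 determinant of the remainders of f and f' modulo q in the basis X, 1.
    wedge : Carrier
    wedge = (u n + (t * u 2 + (t * a * u 1 + t * b * u 0))) * (N * w (suc (suc p)) + (fromℕ 2 * t * w 1 + t * a * w 0))
          - (w n + (t * w 2 + (t * a * w 1 + t * b * w 0))) * (N * u (suc (suc p)) + (fromℕ 2 * t * u 1 + t * a * u 0))

    -- The n - 2 pivots q contribute (t (n - 2))^(n-2), the two minus signs cancelling, and `g*`
    -- contributes one more factor t (n - 2).
    resultant-wedge : resultant n P (suc (suc p)) (deriv P) ≈ t ^ suc (suc p) * (N₂ ^ suc (suc p) * wedge)
    resultant-wedge = begin
      resultant n P (suc (suc p)) (deriv P)
        ≈⟨ det-cong (λ i j → reflexive (sylvester-rows n P (suc (suc p)) (deriv P) i j)) ⟩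
      detRows (suc (suc p) ℕ.+ n) (shifts (suc (suc p)) 0 f ++ shifts n 0 f')
        ≈⟨ reflexive (≡.cong (λ m → detRows m (shifts (suc (suc p)) 0 f ++ shifts n 0 f')) (≡.sym (ℕₚ.+-suc (suc p) n))) ⟩
      detRows (suc p ℕ.+ suc n) (shifts (suc (suc p)) 0 f ++ shifts n 0 f')
        ≈⟨ detRows-sylvester n ⟩
      detRows n (g* ∷ shifts (suc p) 0 g ++ f' ∷ [])
        ≈⟨ detRows-quadratic (suc p) g* f' ⟩
      (- (- t * N₂)) ^ suc p * (evaluate u n g* * evaluate w n f' - evaluate w n g* * evaluate u n f')
        ≈⟨ *-cong (trans (^-cong (suc p) (solve 2 (λ t n → :- (:- t :* n) := t :* n) refl t N₂)) (^-* t N₂ (suc p)))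
             (+-cong (*-cong (evaluate-g* u-recurrent) (evaluate-f' w)) (-‿cong (*-cong (evaluate-g* w-recurrent) (evaluate-f' u)))) ⟩
      t ^ suc p * N₂ ^ suc p * (t * N₂ * U * W' - t * N₂ * W * U')
        ≈⟨ solve 8 (λ t n T M U W U' W' → T :* M :* (t :* n :* U :* W' :- t :* n :* W :* U')
             := t :* T :* (n :* M :* (U :* W' :- W :* U'))) refl t N₂ (t ^ suc p) (N₂ ^ suc p) U W U' W' ⟩
      t ^ suc (suc p) * (N₂ ^ suc (suc p) * wedge) ∎
      where
      U W U' W' : Carrier
      U = u n + (t * u 2 + (t * a * u 1 + t * b * u 0))
      W = w n + (t * w 2 + (t * a * w 1 + t * b * w 0))
      U' = N * u (suc (suc p)) + (fromℕ 2 * t * u 1 + t * a * u 0)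
      W' = N * w (suc (suc p)) + (fromℕ 2 * t * w 1 + t * a * w 0)

  -- The closed form of the discriminant

  ^-neg : ∀ x k → x ^ k ≈ sgn k * (- x) ^ k
  ^-neg x k = trans (^-cong k (solve 1 (λ x → x := (:- :1) :* (:- x)) refl x)) (^-* (- 1#) (- x) k)

  -- The parities of n(n-1)/2 and ⌈(n-3)/2⌉ differ, since both change when n grows by 2.
  sgn-discriminant : ∀ p → sgn ⌊ suc (suc (suc p)) ℕ.* suc (suc p) /2⌋ ≈ - sgn ⌈ p /2⌉
  sgn-discriminant zero = solve 0 (:- :1 :* (:- :1 :* (:- :1 :* :1)) := :- :1) refl
  sgn-discriminant (suc zero) = solve 0 (:- :1 :* (:- :1 :* (:- :1 :* (:- :1 :* (:- :1 :* (:- :1 :* :1))))) := :- (:- :1 :* :1)) refl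
  sgn-discriminant (suc (suc p)) = begin
    sgn ⌊ (5 ℕ.+ p) ℕ.* (4 ℕ.+ p) /2⌋
      ≈⟨ reflexive (≡.cong sgn (⌊n[n-1]/2⌋-step p)) ⟩
    sgn (⌊ (3 ℕ.+ p) ℕ.* (2 ℕ.+ p) /2⌋ ℕ.+ (7 ℕ.+ (p ℕ.+ p)))
      ≈⟨ trans (sgn-+ ⌊ (3 ℕ.+ p) ℕ.* (2 ℕ.+ p) /2⌋ (7 ℕ.+ (p ℕ.+ p))) (*-cong (sgn-discriminant p) (trans (sgn-+ 7 (p ℕ.+ p)) (*-congˡ (sgn-double p)))) ⟩
    - sgn ⌈ p /2⌉ * (sgn 7 * 1#)
      ≈⟨ solve 1 (λ s → :- s :* ((:- :1) :^ 7 :* :1) := :- (:- :1 :* s)) refl (sgn ⌈ p /2⌉) ⟩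
    - sgn ⌈ suc (suc p) /2⌉ ∎

  module ClosedForm (p : ℕ) (a b t : Carrier) where
    open Trinomial p a b t
    open Quadratic σ ε

    L : ℕ → Carrier
    L = lucas (N₁ * a) (- (N * N₂ * b))

    -- Scaling by (- N₂)^k clears the denominators of σ and ε and turns the recurrence of `u` into
    -- that of `L`.
    lucas-u : ∀ k → (- N₂) ^ k * u (suc k) ≈ L k
    lucas-u zero = solve 1 (λ σ → :1 :* (:1 :- σ :* con (+ 0)) := :1) refl σ
    lucas-u (suc zero) = trans
      (solve 3 (λ m σ ε → (:- m :* :1) :* (:- (ε :* con (+ 0)) :- σ :* (:1 :- σ :* con (+ 0))) := m :* σ) refl N₂ σ ε)
      N₂σ
    lucas-u (suc (suc k)) = begin
      - N₂ * (- N₂ * M) * u (suc (suc (suc k)))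
        ≈⟨ *-congˡ (u-recurrent (suc k)) ⟩
      - N₂ * (- N₂ * M) * - (σ * u₂ + ε * u₁)
        ≈⟨ solve 6 (λ m M σ ε x y → :- m :* (:- m :* M) :* :- (σ :* x :+ ε :* y)
             := m :* σ :* (:- m :* M :* x) :+ (:- (m :* ε :* m)) :* (M :* y)) refl N₂ M σ ε u₂ u₁ ⟩
      N₂ * σ * (- N₂ * M * u₂) + - (N₂ * ε * N₂) * (M * u₁)
        ≈⟨ +-cong (*-cong N₂σ (lucas-u (suc k)))
                  (*-cong (-‿cong (trans (*-congʳ N₂ε) (solve 3 (λ n b m → n :* b :* m := n :* m :* b) refl N b N₂))) (lucas-u k)) ⟩
      N₁ * a * L (suc k) + - (N * N₂ * b) * L k ∎
      where
      M u₁ u₂ : Carrier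
      M = (- N₂) ^ k
      u₁ = u (suc k)
      u₂ = u (suc (suc k))

    -- The coefficient of t as the elimination delivers it, in terms of U_(n-2) and U_(n-3).
    γ : Carrier
    γ = sgn p * (L (suc p) * (fromℕ 4 * N * b - N₁ * a ^ 2) - fromℕ 2 * a * (N * b) * L p)

    -- The constant term in t is n times the norm of X^(n-1), which `norm` evaluates. Thanks to the
    -- factor N₂, all other occurrences of σ and ε are in N₂ σ and N₂ ε.
    wedge-expand : N₂ * wedge ≈ N * (N₂ * ε ^ suc (suc p))
      + t * (u (suc (suc p)) * (fromℕ 4 * N * b - N₁ * a ^ 2) - fromℕ 2 * a * w (suc (suc p)))
      - t ^ 2 * (a ^ 2 - fromℕ 4 * b)
    wedge-expand = begin
      N₂ * wedge
        ≈⟨ solve 9 (λ m n a b t σ ε y z →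
             let u₁ = :1 :- σ :* con (+ 0) ; w₁ = :- (ε :* con (+ 0)) in
             m :* ((z :- σ :* y :+ (t :* (w₁ :- σ :* u₁) :+ (t :* a :* u₁ :+ t :* b :* con (+ 0))))
                     :* (n :* z :+ (con (+ 2) :* t :* w₁ :+ t :* a :* :1))
                :- (:- (ε :* y) :+ (t :* (:- (ε :* u₁)) :+ (t :* a :* w₁ :+ t :* b :* :1)))
                     :* (n :* y :+ (con (+ 2) :* t :* u₁ :+ t :* a :* con (+ 0))))
             := n :* (m :* (z :* z :- σ :* y :* z :+ ε :* (y :* y)))
             :+ t :* (a :* (m :* z :- m :* σ :* y) :+ (m :* a :- m :* σ) :* n :* z
                  :+ con (+ 2) :* (m :* ε) :* y :- (m :* b :- m :* ε) :* n :* y)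
             :+ t :^ 2 :* ((m :* a :- m :* σ) :* a :- con (+ 2) :* (m :* b :- m :* ε))) refl
             N₂ N a b t σ ε y z ⟩
      N * (N₂ * (z * z - σ * y * z + ε * (y * y)))
        + t * (a * (N₂ * z - N₂ * σ * y) + (N₂ * a - N₂ * σ) * N * z
          + fromℕ 2 * (N₂ * ε) * y - (N₂ * b - N₂ * ε) * N * y)
        + t ^ 2 * ((N₂ * a - N₂ * σ) * a - fromℕ 2 * (N₂ * b - N₂ * ε))
        ≈⟨ +-cong (+-cong (*-congˡ (*-congˡ (norm (suc (suc p)))))
             (*-congˡ (+-cong (+-cong (+-cong (*-congˡ (+-congˡ (-‿cong (*-congʳ N₂σ)))) (*-congʳ (*-congʳ (+-congˡ (-‿cong N₂σ)))))
               (*-congʳ (*-congˡ N₂ε))) (-‿cong (*-congʳ (*-congʳ (+-congˡ (-‿cong N₂ε))))))))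
             (*-congˡ (+-cong (*-congʳ (+-congˡ (-‿cong N₂σ))) (-‿cong (*-congˡ (+-congˡ (-‿cong N₂ε)))))) ⟩
      N * (N₂ * ε ^ suc (suc p))
        + t * (a * (N₂ * z - N₁ * a * y) + (N₂ * a - N₁ * a) * N * z
          + fromℕ 2 * (N * b) * y - (N₂ * b - N * b) * N * y)
        + t ^ 2 * ((N₂ * a - N₁ * a) * a - fromℕ 2 * (N₂ * b - N * b))
        -- By definition N₁ is 1 + N₂ and N is 1 + N₁, so the differences N₂ - N₁ and N₂ - N
        -- collapse to - 1 and - 2.
        ≈⟨ solve 7 (λ m a b t y z e → let n₁ = :1 :+ m ; n = :1 :+ n₁ in
             n :* (m :* e) :+ t :* (a :* (m :* z :- n₁ :* a :* y) :+ (m :* a :- n₁ :* a) :* n :* z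
                  :+ con (+ 2) :* (n :* b) :* y :- (m :* b :- n :* b) :* n :* y)
             :+ t :^ 2 :* ((m :* a :- n₁ :* a) :* a :- con (+ 2) :* (m :* b :- n :* b))
             := n :* (m :* e) :+ t :* (y :* (con (+ 4) :* n :* b :- n₁ :* a :^ 2) :- con (+ 2) :* a :* z)
             :- t :^ 2 :* (a :^ 2 :- con (+ 4) :* b)) refl N₂ a b t y z (ε ^ suc (suc p)) ⟩
      N * (N₂ * ε ^ suc (suc p)) + t * (y * (fromℕ 4 * N * b - N₁ * a ^ 2) - fromℕ 2 * a * z)
        - t ^ 2 * (a ^ 2 - fromℕ 4 * b) ∎
      where
      y z : Carrier
      y = u (suc (suc p))
      z = w (suc (suc p))

    -- The powers of N₂ clear all denominators: ε^(n-1) takes n - 1 of them, u_(n-1) takes n - 2,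
    -- and w_(n-1) = - ε u_(n-2) takes one for ε and n - 3 for u_(n-2).
    wedge-closed : N₂ ^ suc (suc p) * wedge ≈
      - (N₂ ^ suc p * (a ^ 2 - fromℕ 4 * b) * t ^ 2 + γ * t - N ^ n * b ^ suc (suc p))
    wedge-closed = begin
      N₂ * M * wedge
        ≈⟨ solve 3 (λ m M W → m :* M :* W := M :* (m :* W)) refl N₂ M wedge ⟩
      M * (N₂ * wedge)
        ≈⟨ *-congˡ wedge-expand ⟩
      M * (N * (N₂ * ε ^ suc (suc p)) + t * (y * X - fromℕ 2 * a * - (ε * u₁)) - t ^ 2 * D)
        ≈⟨ solve 12 (λ n m M M' e t y X a ε u₁ D →
             M :* (n :* (m :* e) :+ t :* (y :* X :- con (+ 2) :* a :* :- (ε :* u₁)) :- t :^ 2 :* D)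
             := n :* (m :* M :* e) :+ t :* (M :* y :* X :+ con (+ 2) :* a :* (ε :* (M :* u₁))) :- t :^ 2 :* M :* D)
             refl N N₂ M (N₂ ^ p) (ε ^ suc (suc p)) t y X a ε u₁ D ⟩
      N * (N₂ ^ suc (suc p) * ε ^ suc (suc p)) + t * (M * y * X + fromℕ 2 * a * (ε * (N₂ * N₂ ^ p * u₁))) - t ^ 2 * M * D
        ≈⟨ +-congʳ (+-cong
             (*-congˡ (trans (sym (^-* N₂ ε (suc (suc p)))) (trans (^-cong (suc (suc p)) N₂ε) (^-* N b (suc (suc p))))))
             (*-congˡ (+-cong (*-congʳ (scaled (suc p))) (*-congˡ
               (trans (solve 4 (λ ε m P u → ε :* (m :* P :* u) := m :* ε :* (P :* u)) refl ε N₂ (N₂ ^ p) u₁)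
                 (*-cong N₂ε (scaled p))))))) ⟩
      N * (N ^ suc (suc p) * b ^ suc (suc p))
        + t * (- 1# * s * L (suc p) * X + fromℕ 2 * a * (N * b * (s * L p))) - t ^ 2 * M * D
        ≈⟨ solve 12 (λ n P B t s L₁ L₀ X a b M D →
             n :* (P :* B) :+ t :* ((:- :1) :* s :* L₁ :* X :+ con (+ 2) :* a :* (n :* b :* (s :* L₀))) :- t :^ 2 :* M :* D
             := :- (M :* D :* t :^ 2 :+ s :* (L₁ :* X :- con (+ 2) :* a :* (n :* b) :* L₀) :* t :- n :* P :* B))
             refl N (N ^ suc (suc p)) (b ^ suc (suc p)) t s (L (suc p)) (L p) X a b M D ⟩
      - (M * D * t ^ 2 + γ * t - N ^ n * b ^ suc (suc p)) ∎
      where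
      M D X s y u₁ : Carrier
      M = N₂ ^ suc p
      D = a ^ 2 - fromℕ 4 * b
      X = fromℕ 4 * N * b - N₁ * a ^ 2
      s = sgn p
      y = u (suc (suc p))
      u₁ = u (suc p)
      scaled : ∀ k → N₂ ^ k * u (suc k) ≈ sgn k * L k
      scaled k = trans (*-congʳ (^-neg N₂ k)) (trans (*-assoc _ _ _) (*-congˡ (lucas-u k)))

    discriminant-closed : Δfc n a b t ≈ rhs₂ n a b t γ
    discriminant-closed = begin
      sgn ⌊ n ℕ.* suc (suc p) /2⌋ * ((P n ⁻¹) * resultant n P (suc (suc p)) (deriv P))
        ≈⟨ *-cong (sgn-discriminant p) (*-cong (trans (⁻¹-cong P-leading) 1⁻¹≈1)
             (trans resultant-wedge (*-congˡ wedge-closed))) ⟩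
      - sgn ⌈ p /2⌉ * (1# * (t ^ suc (suc p) * - Y))
        ≈⟨ solve 3 (λ s T Y → :- s :* (:1 :* (T :* :- Y)) := s :* T :* Y) refl (sgn ⌈ p /2⌉) (t ^ suc (suc p)) Y ⟩
      sgn ⌈ p /2⌉ * t ^ suc (suc p) * Y ∎
      where
      Y : Carrier
      Y = N₂ ^ suc p * (a ^ 2 - fromℕ 4 * b) * t ^ 2 + γ * t - N ^ n * b ^ suc (suc p)

  -- The elimination covers n = 3 as p = 0, where U_1 = 2a and U_0 = 1.
  discriminant-cubic : ∀ a b t → Δfc 3 a b t ≈ rhs₁ a b t
  discriminant-cubic a b t = trans (ClosedForm.discriminant-closed 0 a b t)
    (solve 3 (λ a b t → let n = con (+ 3) ; n₁ = con (+ 2) ; m = con (+ 1) ; D = a :^ 2 :- con (+ 4) :* b in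
        :1 :* t :^ 2 :* (m :^ 1 :* D :* t :^ 2
          :+ :1 :* (n₁ :* a :* (con (+ 4) :* n :* b :- n₁ :* a :^ 2) :- con (+ 2) :* a :* (n :* b) :* :1) :* t
          :- n :^ 3 :* b :^ 2)
        := t :^ 2 :* (D :* t :^ 2 :- (con (+ 4) :* a :^ 3 :- con (+ 18) :* a :* b) :* t :- con (+ 27) :* b :^ 2))
      refl a b t)

  -- Binomial sums

  sumTo-cong : ∀ K {f g : ℕ → Carrier} → (∀ k → k ℕ.≤ K → f k ≈ g k) → sumTo K f ≈ sumTo K g
  sumTo-cong zero f≈g = f≈g 0 z≤n
  sumTo-cong (suc K) f≈g = +-cong (sumTo-cong K λ k k≤K → f≈g k (ℕₚ.m≤n⇒m≤1+n k≤K)) (f≈g (suc K) ℕₚ.≤-refl)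

  sumTo-linear : ∀ K α β (f g : ℕ → Carrier) → sumTo K (λ k → α * f k + β * g k) ≈ α * sumTo K f + β * sumTo K g
  sumTo-linear zero α β f g = refl
  sumTo-linear (suc K) α β f g = trans (+-congʳ (sumTo-linear K α β f g))
    (solve 6 (λ α β x y u v → α :* x :+ β :* y :+ (α :* u :+ β :* v) := α :* (x :+ u) :+ β :* (y :+ v)) refl
      α β (sumTo K f) (sumTo K g) (f (suc K)) (g (suc K)))

  sumTo-suc : ∀ K f → sumTo (suc K) f ≈ f 0 + sumTo K (f ∘ suc)
  sumTo-suc zero f = refl
  sumTo-suc (suc K) f = trans (+-congʳ (sumTo-suc K f)) (+-assoc _ _ _)

  fromℕ-cong : ∀ {m n} → m ≡ n → fromℕ m ≈ fromℕ n
  fromℕ-cong = reflexive ∘ ≡.cong fromℕ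

  lucas-odd : ∀ {x} y k → x ≈ 0# → lucas x y (suc (k ℕ.+ k)) ≈ 0#
  lucas-odd y zero x≈0 = x≈0
  lucas-odd {x} y (suc k) x≈0 = begin
    lucas x y (suc (suc k ℕ.+ suc k))
      ≈⟨ reflexive (≡.cong (λ m → lucas x y (suc (suc m))) (ℕₚ.+-suc k k)) ⟩
    x * lucas x y (suc (suc (k ℕ.+ k))) + y * lucas x y (suc (k ℕ.+ k))
      ≈⟨ +-cong (trans (*-congʳ x≈0) (zeroˡ _)) (trans (*-congˡ (lucas-odd y k x≈0)) (zeroʳ _)) ⟩
    0# + 0#  ≈⟨ +-identityˡ 0# ⟩
    0# ∎

  module LucasSum (x y : Carrier) where

    -- The truncated exponent is harmless: for 2k > p the binomial coefficient vanishes.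
    summand : ℕ → ℕ → Carrier
    summand p k = fromℕ ((p ∸ k) C k) * x ^ (p ∸ (k ℕ.+ k)) * y ^ k

    summand-vanishes : ∀ p k → (p ∸ k) ℕ.< k → summand p k ≈ 0#
    summand-vanishes p k p∸k<k = trans (*-congʳ (trans (*-congʳ (fromℕ-cong (k>n⇒nCk≡0 p∸k<k))) (zeroˡ _))) (zeroˡ _)

    summand-0 : ∀ p → summand p 0 ≈ x ^ p
    summand-0 p = trans (*-identityʳ _) (trans (*-congʳ (trans (fromℕ-cong (nC0≡1 p)) (+-identityʳ 1#))) (*-identityˡ _))

    -- Pascal's rule for C(p-k+1, k+1); for k > p all three summands vanish.
    summand-rec : ∀ p k → summand (suc (suc p)) (suc k) ≈ x * summand (suc p) (suc k) + y * summand p k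
    summand-rec p k with k ℕ.≤? p
    ... | no k≰p = begin
      summand (suc (suc p)) (suc k)
        ≈⟨ summand-vanishes (suc (suc p)) (suc k) (s≤s (ℕₚ.≤-trans (ℕₚ.≤-reflexive (ℕₚ.m≤n⇒m∸n≡0 p<k)) z≤n)) ⟩
      0#
        ≈⟨ solve 2 (λ x y → con (+ 0) := x :* con (+ 0) :+ y :* con (+ 0)) refl x y ⟩
      x * 0# + y * 0#
        ≈⟨ sym (+-cong (*-congˡ (summand-vanishes (suc p) (suc k) (ℕₚ.≤-<-trans (ℕₚ.≤-reflexive p∸k≡0) (s≤s z≤n))))
                       (*-congˡ (summand-vanishes p k (ℕₚ.≤-<-trans (ℕₚ.≤-reflexive p∸k≡0) (ℕₚ.≤-<-trans z≤n p<k))))) ⟩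
      x * summand (suc p) (suc k) + y * summand p k ∎
      where
      p<k : p ℕ.< k
      p<k = ℕₚ.≰⇒> k≰p
      p∸k≡0 : p ∸ k ≡ 0
      p∸k≡0 = ℕₚ.m≤n⇒m∸n≡0 (ℕₚ.<⇒≤ p<k)
    ... | yes k≤p = begin
      fromℕ ((suc p ∸ k) C suc k) * x ^ (suc p ∸ (k ℕ.+ suc k)) * (y * y ^ k)
        ≈⟨ *-congʳ (*-cong
             (trans (fromℕ-cong (≡.trans (≡.cong (_C suc k) (ℕₚ.+-∸-assoc 1 k≤p)) (≡.sym (nCk+nC[k+1]≡[n+1]C[k+1] (p ∸ k) k))))
                    (fromℕ-+ ((p ∸ k) C k) ((p ∸ k) C suc k)))
             (reflexive (≡.cong (λ m → x ^ (suc p ∸ m)) (ℕₚ.+-suc k k)))) ⟩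
      (A + B) * e * (y * y ^ k)
        ≈⟨ solve 5 (λ A B e y Y → (A :+ B) :* e :* (y :* Y) := B :* e :* (y :* Y) :+ y :* (A :* e :* Y)) refl A B e y (y ^ k) ⟩
      B * e * (y * y ^ k) + y * (A * e * y ^ k)
        ≈⟨ +-congʳ (*-congʳ step) ⟩
      x * (B * e') * (y * y ^ k) + y * (A * e * y ^ k)
        ≈⟨ +-congʳ (trans (*-assoc _ _ _) (*-congˡ (*-congʳ (*-congˡ (reflexive (≡.cong (λ m → x ^ (p ∸ m)) (≡.sym (ℕₚ.+-suc k k)))))))) ⟩
      x * summand (suc p) (suc k) + y * summand p k ∎
      where
      A B e e' : Carrier
      A = fromℕ ((p ∸ k) C k)
      B = fromℕ ((p ∸ k) C suc k)
      e = x ^ (p ∸ (k ℕ.+ k))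
      e' = x ^ (p ∸ suc (k ℕ.+ k))
      step : B * e ≈ x * (B * e')
      step with suc (k ℕ.+ k) ℕ.≤? p
      ... | yes 2k<p = trans (*-congˡ (reflexive (≡.cong (x ^_) (ℕₚ.+-∸-assoc 1 2k<p))))
                         (solve 3 (λ b x e → b :* (x :* e) := x :* (b :* e)) refl B x e')
      -- Truncation makes both exponents 0 here, so no factor x can be split off; but B = 0.
      ... | no 2k≮p = trans (*-congʳ B≈0) (trans (zeroˡ _) (sym (trans (*-congˡ (trans (*-congʳ B≈0) (zeroˡ _))) (zeroʳ _))))
        where
        B≈0 : B ≈ 0#
        B≈0 = fromℕ-cong (k>n⇒nCk≡0 (s≤s (ℕₚ.m≤n+o⇒m∸n≤o p k (ℕₚ.≤-pred (ℕₚ.≰⇒> 2k≮p)))))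

    -- The bound `K` is free beyond ⌊p/2⌋ because sums for consecutive indices must share one upper
    -- limit, both in the recursion and in the sum of the theorem.
    sumTo-summand : ∀ p K → ⌊ p /2⌋ ℕ.≤ K → sumTo K (summand p) ≈ lucas x y p
    sumTo-summand zero zero _ = summand-0 0
    sumTo-summand zero (suc K) _ = trans (+-cong (sumTo-summand zero K z≤n) (summand-vanishes 0 (suc K) (s≤s z≤n))) (+-identityʳ 1#)
    sumTo-summand (suc zero) zero _ = trans (summand-0 1) (*-identityʳ x)
    sumTo-summand (suc zero) (suc K) _ = trans
      (+-cong (sumTo-summand 1 K z≤n) (summand-vanishes 1 (suc K) (s≤s (ℕₚ.≤-trans (ℕₚ.≤-reflexive (ℕₚ.0∸n≡0 K)) z≤n)))) (+-identityʳ x)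
    sumTo-summand (suc (suc p)) (suc K) (s≤s p/2≤K) = begin
      sumTo (suc K) (summand (suc (suc p)))
        ≈⟨ sumTo-suc K (summand (suc (suc p))) ⟩
      summand (suc (suc p)) 0 + sumTo K (summand (suc (suc p)) ∘ suc)
        ≈⟨ +-cong (trans (summand-0 (suc (suc p))) (*-congˡ (sym (summand-0 (suc p)))))
                  (trans (sumTo-cong K λ k _ → summand-rec p k) (sumTo-linear K x y (summand (suc p) ∘ suc) (summand p))) ⟩
      x * summand (suc p) 0 + (x * sumTo K (summand (suc p) ∘ suc) + y * sumTo K (summand p))
        ≈⟨ trans (sym (+-assoc _ _ _)) (+-congʳ (sym (distribˡ _ _ _))) ⟩
      x * (summand (suc p) 0 + sumTo K (summand (suc p) ∘ suc)) + y * sumTo K (summand p)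
        ≈⟨ +-cong (*-congˡ (trans (sym (sumTo-suc K (summand (suc p))))
                    (sumTo-summand (suc p) (suc K) (ℕₚ.≤-trans (ℕₚ.⌊n/2⌋-mono (ℕₚ.n≤1+n (suc p))) (s≤s p/2≤K)))))
                  (*-congˡ (sumTo-summand p K p/2≤K)) ⟩
      lucas x y (suc (suc p)) ∎

  -- The sum in the theorem as a combination of Lucas terms, with n = p + 4

  module GammaSum (p : ℕ) (a b t : Carrier) where
    open Trinomial (suc p) a b t using (n; N; N₁; N₂)
    open ClosedForm (suc p) a b t using (γ; L)

    x y : Carrier
    x = N₁ * a
    y = - (N * N₂ * b)

    open LucasSum x y

    -- Once the fraction in S_k is resolved, α is the coefficient of C(n-k-3, k) divided by x, and β
    -- the coefficient of C(n-k-4, k). The factor x taken out raises the exponent n - 2k - 4 by one.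
    α β : Carrier
    α = N₁ ^ 2 * a ^ 3 - (fromℕ 4 * N - fromℕ 6) * N * a * b
    β = fromℕ 4 * N ^ 2 * N₂ * b ^ 2 - N * N₂ * a * b * x

    sgn-n : sgn n ≈ - sgn (suc p)
    sgn-n = solve 1 (λ s → :- :1 :* (:- :1 :* (:- :1 :* s)) := :- s) refl (sgn (suc p))

    -- One step of the recurrence replaces U_(n-2) in γ by U_(n-3) and U_(n-4); the coefficients
    -- then agree as polynomials in n - 2, a and b.
    γ-lucas : sgn n * (α * L (suc p) + β * L p) ≈ γ
    γ-lucas = trans (*-congʳ sgn-n)
      (solve 6 (λ s m a b L₁ L₀ → let n₁ = :1 :+ m ; n = :1 :+ n₁ ; x = n₁ :* a in
        :- s :* ((n₁ :^ 2 :* a :^ 3 :- (con (+ 4) :* n :- con (+ 6)) :* n :* a :* b) :* L₁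
          :+ (con (+ 4) :* n :^ 2 :* m :* b :^ 2 :- n :* m :* a :* b :* x) :* L₀)
        := s :* ((x :* L₁ :+ :- (n :* m :* b) :* L₀) :* (con (+ 4) :* n :* b :- n₁ :* a :^ 2)
          :- con (+ 2) :* a :* (n :* b) :* L₁)) refl (sgn (suc p)) N₂ a b (L (suc p)) (L p))

    module Term (k : ℕ) (2k≤1+p : k ℕ.+ k ℕ.≤ suc p) where

      m : ℕ
      m = p ∸ k

      C₁ C₂ κ μ : Carrier
      C₁ = fromℕ (suc m C k)
      C₂ = fromℕ (m C k)
      κ = fromℕ k
      μ = fromℕ (suc m)

      k≤p : k ℕ.≤ p
      k≤p = bound k 2k≤1+p
        where
        bound : ∀ k → k ℕ.+ k ℕ.≤ suc p → k ℕ.≤ p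
        bound zero _ = z≤n
        bound (suc k) (s≤s k+k≤p) = ℕₚ.≤-trans (ℕₚ.m≤n+m (suc k) k) k+k≤p

      1+p∸k : suc p ∸ k ≡ suc m
      1+p∸k = ℕₚ.+-∸-assoc 1 k≤p

      n∸k∸3 : n ∸ k ∸ 3 ≡ suc m
      n∸k∸3 = ≡.trans (ℕₚ.∸-+-assoc n k 3) (≡.trans (≡.cong (n ∸_) (ℕₚ.+-comm k 3)) 1+p∸k)

      n∸k∸4 : n ∸ k ∸ 4 ≡ m
      n∸k∸4 = ≡.trans (ℕₚ.∸-+-assoc n k 4) (≡.cong (n ∸_) (ℕₚ.+-comm k 4))

      N₂≈ : N₂ ≈ 1# + (μ + κ)
      N₂≈ = +-congˡ (trans (fromℕ-cong (≡.cong suc (≡.sym (ℕₚ.m∸n+n≡m k≤p)))) (fromℕ-+ (suc m) k))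

      absorption : μ * C₂ ≈ (μ - κ) * C₁
      absorption = begin
        μ * C₂                       ≈⟨ solve 2 (λ u v → u := u :+ v :- v) refl (μ * C₂) (κ * C₁) ⟩
        μ * C₂ + κ * C₁ - κ * C₁     ≈⟨ +-congʳ (sym (trans (fromℕ-+ (suc m ℕ.* (m C k)) (k ℕ.* (suc m C k))) (+-cong (fromℕ-* (suc m) (m C k)) (fromℕ-* k (suc m C k))))) ⟩
        fromℕ (suc m ℕ.* (m C k) ℕ.+ k ℕ.* (suc m C k)) - κ * C₁
                                     ≈⟨ +-congʳ (trans (fromℕ-cong (C-absorption′ m k)) (fromℕ-* (suc m) (suc m C k))) ⟩
        μ * C₁ - κ * C₁              ≈⟨ solve 3 (λ u v c → u :* c :- v :* c := (u :- v) :* c) refl μ κ C₁ ⟩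
        (μ - κ) * C₁                 ∎

      -- Spelled exactly as in `S`, so that `S-expand` can match it.
      quadratic numerator : ℤ
      quadratic = ((+ 5) ℤ.* (+ n) ℤ.* (+ n) ℤ.- (+ (6 ℕ.* k ℕ.+ 23)) ℤ.* (+ n) ℤ.+ + (10 ℕ.* k ℕ.+ 24))
      numerator = (+ n) ℤ.* ((+ n) ℤ.- + 1) ℤ.* quadratic

      fromℤ-sub : ∀ i j → fromℤ (i ℤ.- j) ≈ fromℤ i - fromℤ j
      fromℤ-sub i j = trans (fromℤ-+ i (ℤ.- j)) (+-congˡ (fromℤ-neg j))

      fromℤ-numerator : fromℤ numerator ≈ N * (N - fromℕ 1) *
        (fromℕ 5 * N * N - (fromℕ 6 * κ + fromℕ 23) * N + (fromℕ 10 * κ + fromℕ 24))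
      fromℤ-numerator = trans (fromℤ-* (+ n ℤ.* (+ n ℤ.- + 1)) quadratic) (*-cong
        (trans (fromℤ-* (+ n) (+ n ℤ.- + 1)) (*-congˡ (fromℤ-sub (+ n) (+ 1))))
        (trans (fromℤ-+ ((+ 5) ℤ.* (+ n) ℤ.* (+ n) ℤ.- (+ (6 ℕ.* k ℕ.+ 23)) ℤ.* (+ n)) (+ (10 ℕ.* k ℕ.+ 24))) (+-cong
          (trans (fromℤ-sub ((+ 5) ℤ.* (+ n) ℤ.* (+ n)) ((+ (6 ℕ.* k ℕ.+ 23)) ℤ.* (+ n))) (+-cong
            (trans (fromℤ-* ((+ 5) ℤ.* (+ n)) (+ n)) (*-congʳ (fromℤ-* (+ 5) (+ n))))
            (-‿cong (trans (fromℤ-* (+ (6 ℕ.* k ℕ.+ 23)) (+ n)) (*-congʳ (affine 6 23))))))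
          (affine 10 24))))
        where
        affine : ∀ i j → fromℕ (i ℕ.* k ℕ.+ j) ≈ fromℕ i * κ + fromℕ j
        affine i j = trans (fromℕ-+ (i ℕ.* k) j) (+-congʳ (fromℕ-* i k))

      -- The identity 5n² - (6k+23)n + 10k + 24 = (4n-6)(n-k-3) + (n-2)(n-2k-3), checked after
      -- writing n as μ + κ + 3.
      numerator-factor : fromℤ numerator ≈ N * N₁ * ((fromℕ 4 * N - fromℕ 6) * μ + N₂ * (μ - κ))
      numerator-factor = begin
        fromℤ numerator ≈⟨ fromℤ-numerator ⟩
        N * (N - fromℕ 1) * (fromℕ 5 * N * N - (fromℕ 6 * κ + fromℕ 23) * N + (fromℕ 10 * κ + fromℕ 24))
          ≈⟨ *-cong (*-congˡ (+-congʳ N≈)) (+-congʳ (+-cong (*-cong (*-congˡ N≈) N≈) (-‿cong (*-congˡ N≈)))) ⟩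
        N * (N' - fromℕ 1) * (fromℕ 5 * N' * N' - (fromℕ 6 * κ + fromℕ 23) * N' + (fromℕ 10 * κ + fromℕ 24))
          ≈⟨ solve 3 (λ N μ κ → let m = :1 :+ (μ :+ κ) ; n₁ = :1 :+ m ; n = :1 :+ n₁ in
               N :* (n :- con (+ 1)) :* (con (+ 5) :* n :* n :- (con (+ 6) :* κ :+ con (+ 23)) :* n :+ (con (+ 10) :* κ :+ con (+ 24)))
               := N :* n₁ :* ((con (+ 4) :* n :- con (+ 6)) :* μ :+ m :* (μ :- κ))) refl N μ κ ⟩
        N * (1# + (1# + (μ + κ))) * ((fromℕ 4 * N' - fromℕ 6) * μ + (1# + (μ + κ)) * (μ - κ))
          ≈⟨ *-cong (*-congˡ (+-congˡ (sym N₂≈))) (+-cong (*-congʳ (+-congʳ (*-congˡ (sym N≈)))) (*-congʳ (sym N₂≈))) ⟩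
        N * N₁ * ((fromℕ 4 * N - fromℕ 6) * μ + N₂ * (μ - κ)) ∎
        where
        N' : Carrier
        N' = 1# + (1# + (1# + (μ + κ)))
        N≈ : N ≈ N'
        N≈ = +-congˡ (+-congˡ N₂≈)

      -- The first part of the factored numerator contains μ outright; in the second, `absorption`
      -- turns (μ - κ) C₁ into μ C₂. So μ cancels from both.
      quotient-term : fromℤ numerator * (μ ⁻¹) * C₁ ≈ N * N₁ * ((fromℕ 4 * N - fromℕ 6) * C₁ + N₂ * C₂)
      quotient-term = begin
        fromℤ numerator * (μ ⁻¹) * C₁
          ≈⟨ *-congʳ (*-congʳ numerator-factor) ⟩
        N * N₁ * ((fromℕ 4 * N - fromℕ 6) * μ + N₂ * (μ - κ)) * (μ ⁻¹) * C₁
          ≈⟨ solve 7 (λ M q μ i m d C → M :* (q :* μ :+ m :* d) :* i :* C := M :* (q :* (μ :* i) :* C :+ m :* (d :* C) :* i))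
               refl (N * N₁) (fromℕ 4 * N - fromℕ 6) μ (μ ⁻¹) N₂ (μ - κ) C₁ ⟩
        N * N₁ * ((fromℕ 4 * N - fromℕ 6) * (μ * μ ⁻¹) * C₁ + N₂ * ((μ - κ) * C₁) * μ ⁻¹)
          ≈⟨ *-congˡ (+-congˡ (*-congʳ (*-congˡ (sym absorption)))) ⟩
        N * N₁ * ((fromℕ 4 * N - fromℕ 6) * (μ * μ ⁻¹) * C₁ + N₂ * (μ * C₂) * μ ⁻¹)
          ≈⟨ solve 7 (λ M q μ i m C₂ C → M :* (q :* (μ :* i) :* C :+ m :* (μ :* C₂) :* i) := M :* (q :* (μ :* i) :* C :+ m :* (μ :* i) :* C₂))
               refl (N * N₁) (fromℕ 4 * N - fromℕ 6) μ (μ ⁻¹) N₂ C₂ C₁ ⟩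
        N * N₁ * ((fromℕ 4 * N - fromℕ 6) * (μ * μ ⁻¹) * C₁ + N₂ * (μ * μ ⁻¹) * C₂)
          ≈⟨ *-congˡ (+-cong (*-congʳ (trans (*-congˡ (⁻¹-inverse μ (char0 m))) (*-identityʳ _)))
                             (*-congʳ (trans (*-congˡ (⁻¹-inverse μ (char0 m))) (*-identityʳ _)))) ⟩
        N * N₁ * ((fromℕ 4 * N - fromℕ 6) * C₁ + N₂ * C₂) ∎

      S-expand : S n k a b ≈ N₁ ^ 3 * C₁ * a ^ 4
        - N * N₁ * ((fromℕ 4 * N - fromℕ 6) * C₁ + N₂ * C₂) * a ^ 2 * b
        + fromℕ 4 * N ^ 2 * N₂ * C₂ * b ^ 2
      S-expand rewrite n∸k∸3 | n∸k∸4 = +-congʳ (+-congˡ (-‿cong (*-congʳ (*-congʳ quotient-term))))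

      exponent : ℤ
      exponent = (+ n) ℤ.- (+ (2 ℕ.* k ℕ.+ 4))

      E : Carrier
      E = N₁ ^ℤ exponent * a ^ℤ exponent

      -- The exponent is p - 2k, which is -1 exactly when n = 2k + 3; then C₂ = 0.
      E-spec : (¬ a ≈ 0#) ⊎ ((a ≈ 0#) × (2 ∣ n)) →
        (E * x ≈ x ^ (suc p ∸ (k ℕ.+ k))) × (E * C₂ ≈ x ^ (p ∸ (k ℕ.+ k)) * C₂)
      E-spec hyp with k ℕ.+ k ℕ.≤? p
      ... | yes 2k≤p = E*x , *-congʳ E≈
        where
        r : ℕ
        r = p ∸ (k ℕ.+ k)
        exponent≡ : exponent ≡ + r
        exponent≡ = ≡.trans (ℤₚ.m-n≡m⊖n n (2 ℕ.* k ℕ.+ 4))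
          (≡.trans (≡.cong (n ℤ.⊖_) (≡.trans (ℕₚ.+-comm (2 ℕ.* k) 4) (≡.cong (λ i → 4 ℕ.+ (k ℕ.+ i)) (ℕₚ.+-identityʳ k))))
            (ℤₚ.⊖-≥ (s≤s (s≤s (s≤s (s≤s 2k≤p))))))
        E≈ : E ≈ x ^ r
        E≈ = trans (reflexive (≡.cong (λ i → N₁ ^ℤ i * a ^ℤ i) exponent≡)) (sym (^-* N₁ a r))
        E*x : E * x ≈ x ^ (suc p ∸ (k ℕ.+ k))
        E*x = trans (*-congʳ E≈) (trans (*-comm _ _) (reflexive (≡.cong (x ^_) (≡.sym (ℕₚ.+-∸-assoc 1 2k≤p)))))
      ... | no 2k≰p = E*x , trans (*-congˡ C₂≈0) (trans (zeroʳ _) (sym (trans (*-congˡ C₂≈0) (zeroʳ _))))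
        where
        2k≡1+p : k ℕ.+ k ≡ suc p
        2k≡1+p = ℕₚ.≤-antisym 2k≤1+p (ℕₚ.≰⇒> 2k≰p)
        a≉0 : ¬ a ≈ 0#
        a≉0 = nonzero hyp
          where
          nonzero : (¬ a ≈ 0#) ⊎ ((a ≈ 0#) × (2 ∣ n)) → ¬ a ≈ 0#
          nonzero (inj₁ a≉0) = a≉0
          -- With 2k = p + 1 the degree n = 2k + 3 is odd, which rules out the case a = 0 with n
          -- even.
          nonzero (inj₂ (_ , 2∣n)) = contradiction
            (≡.subst (2 ∣_) (≡.cong (suc ∘ suc ∘ suc) (≡.sym 2k≡1+p)) 2∣n)
            λ 2∣3+2k → 2∤1+k+k (suc k) (≡.subst (2 ∣_) (≡.cong (suc ∘ suc) (≡.sym (ℕₚ.+-suc k k))) 2∣3+2k)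
        C₂≈0 : C₂ ≈ 0#
        C₂≈0 = fromℕ-cong (k>n⇒nCk≡0 (ℕₚ.m<n+o⇒m∸n<o p k {{ℕ.>-nonZero k>0}} (ℕₚ.≤-reflexive (≡.sym 2k≡1+p))))
          where
          k>0 : 0 ℕ.< k
          k>0 = ℕₚ.n≢0⇒n>0 λ k≡0 → contradiction (≡.trans (≡.sym (≡.cong₂ ℕ._+_ k≡0 k≡0)) 2k≡1+p) λ ()
        exponent≡ : exponent ≡ -[1+ 0 ]
        exponent≡ = ≡.trans (ℤₚ.m-n≡m⊖n n (2 ℕ.* k ℕ.+ 4))
          (≡.trans (≡.cong (n ℤ.⊖_) (≡.trans (ℕₚ.+-comm (2 ℕ.* k) 4) (≡.cong (4 ℕ.+_) (≡.trans (≡.cong (k ℕ.+_) (ℕₚ.+-identityʳ k)) 2k≡1+p))))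
            (≡.trans (ℤₚ.⊖-< (ℕₚ.n<1+n n)) (≡.cong (λ i → ℤ.- (+ i)) (ℕₚ.m+n∸n≡m 1 n))))
        E*x : E * x ≈ x ^ (suc p ∸ (k ℕ.+ k))
        E*x = begin
          E * x
            ≈⟨ *-congʳ (reflexive (≡.cong (λ i → N₁ ^ℤ i * a ^ℤ i) exponent≡)) ⟩
          N₁ ⁻¹ * 1# * (a ⁻¹ * 1#) * (N₁ * a)
            ≈⟨ solve 4 (λ n i a j → i :* :1 :* (j :* :1) :* (n :* a) := n :* i :* (a :* j)) refl N₁ (N₁ ⁻¹) a (a ⁻¹) ⟩
          N₁ * N₁ ⁻¹ * (a * a ⁻¹)
            ≈⟨ trans (*-cong (⁻¹-inverse N₁ (char0 (suc (suc p)))) (⁻¹-inverse a a≉0)) (*-identityˡ 1#) ⟩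
          1#
            ≈⟨ reflexive (≡.cong (x ^_) (≡.sym (≡.trans (≡.cong (suc p ∸_) 2k≡1+p) (ℕₚ.n∸n≡0 (suc p))))) ⟩
          x ^ (suc p ∸ (k ℕ.+ k)) ∎

      y^k : y ^ k ≈ sgn k * (N ^ k * N₂ ^ k * b ^ k)
      y^k = begin
        y ^ k                          ≈⟨ ^-neg y k ⟩
        sgn k * (- y) ^ k              ≈⟨ *-congˡ (^-cong k (-‿involutive _)) ⟩
        sgn k * (N * N₂ * b) ^ k       ≈⟨ *-congˡ (trans (^-* (N * N₂) b k) (*-congʳ (^-* N N₂ k))) ⟩
        sgn k * (N ^ k * N₂ ^ k * b ^ k) ∎

      γ-term : (¬ a ≈ 0#) ⊎ ((a ≈ 0#) × (2 ∣ n)) →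
        sgn (n ℕ.+ k) * N ^ k * N₁ ^ℤ exponent * N₂ ^ k * a ^ℤ exponent * b ^ k * S n k a b
        ≈ sgn n * α * summand (suc p) k + sgn n * β * summand p k
      γ-term hyp = begin
        sgn (n ℕ.+ k) * N ^ k * N₁ ^ℤ exponent * N₂ ^ k * a ^ℤ exponent * b ^ k * S n k a b
          ≈⟨ *-cong (*-congʳ (*-congʳ (*-congʳ (*-congʳ (*-congʳ (sgn-+ n k)))))) S-expand ⟩
        sgn n * sgn k * N ^ k * N₁ ^ℤ exponent * N₂ ^ k * a ^ℤ exponent * b ^ k * S'
          ≈⟨ solve 8 (λ s σ n e m f b S → s :* σ :* n :* e :* m :* f :* b :* S := s :* (σ :* (n :* m :* b)) :* (e :* f :* S)) refl
               (sgn n) (sgn k) (N ^ k) (N₁ ^ℤ exponent) (N₂ ^ k) (a ^ℤ exponent) (b ^ k) S' ⟩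
        sgn n * (sgn k * (N ^ k * N₂ ^ k * b ^ k)) * (E * S')
          ≈⟨ *-cong (*-congˡ (sym y^k))
               (solve 8 (λ n n₁ m a b E C₁ C₂ → let q = con (+ 4) :* n :- con (+ 6) in
                 E :* (n₁ :^ 3 :* C₁ :* a :^ 4 :- n :* n₁ :* (q :* C₁ :+ m :* C₂) :* a :^ 2 :* b :+ con (+ 4) :* n :^ 2 :* m :* C₂ :* b :^ 2)
                 := (n₁ :^ 2 :* a :^ 3 :- q :* n :* a :* b) :* (E :* (n₁ :* a) :* C₁)
                    :+ (con (+ 4) :* n :^ 2 :* m :* b :^ 2 :- n :* m :* a :* b :* (n₁ :* a)) :* (E :* C₂)) refl
                 N N₁ N₂ a b E C₁ C₂) ⟩
        sgn n * y ^ k * (α * (E * x * C₁) + β * (E * C₂))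
          ≈⟨ *-congˡ (+-cong (*-congˡ (*-cong (proj₁ (E-spec hyp)) (fromℕ-cong (≡.cong (_C k) (≡.sym 1+p∸k)))))
                             (*-congˡ (proj₂ (E-spec hyp)))) ⟩
        sgn n * y ^ k * (α * (x ^ (suc p ∸ (k ℕ.+ k)) * fromℕ ((suc p ∸ k) C k)) + β * (x ^ (p ∸ (k ℕ.+ k)) * C₂))
          ≈⟨ solve 8 (λ s Y α β e f C D → s :* Y :* (α :* (e :* C) :+ β :* (f :* D)) := s :* α :* (C :* e :* Y) :+ s :* β :* (D :* f :* Y)) refl
               (sgn n) (y ^ k) α β (x ^ (suc p ∸ (k ℕ.+ k))) (x ^ (p ∸ (k ℕ.+ k))) (fromℕ ((suc p ∸ k) C k)) C₂ ⟩
        sgn n * α * summand (suc p) k + sgn n * β * summand p k ∎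
        where
        S' : Carrier
        S' = N₁ ^ 3 * C₁ * a ^ 4
          - N * N₁ * ((fromℕ 4 * N - fromℕ 6) * C₁ + N₂ * C₂) * a ^ 2 * b
          + fromℕ 4 * N ^ 2 * N₂ * C₂ * b ^ 2

    γsum-lucas : (¬ a ≈ 0#) ⊎ ((a ≈ 0#) × (2 ∣ n)) → γsum n a b ≈ γ
    γsum-lucas hyp = begin
      γsum n a b
        ≈⟨ sumTo-cong ⌊ suc p /2⌋ (λ k k≤ → Term.γ-term k (k≤⌊n/2⌋⇒k+k≤n (suc p) k≤) hyp) ⟩
      sumTo ⌊ suc p /2⌋ (λ k → sgn n * α * summand (suc p) k + sgn n * β * summand p k)
        ≈⟨ sumTo-linear ⌊ suc p /2⌋ (sgn n * α) (sgn n * β) (summand (suc p)) (summand p) ⟩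
      sgn n * α * sumTo ⌊ suc p /2⌋ (summand (suc p)) + sgn n * β * sumTo ⌊ suc p /2⌋ (summand p)
        ≈⟨ +-cong (*-congˡ (sumTo-summand (suc p) ⌊ suc p /2⌋ ℕₚ.≤-refl))
                  (*-congˡ (sumTo-summand p ⌊ suc p /2⌋ (ℕₚ.⌊n/2⌋-mono (ℕₚ.n≤1+n p)))) ⟩
      sgn n * α * L (suc p) + sgn n * β * L p
        ≈⟨ solve 5 (λ s α β x y → s :* α :* x :+ s :* β :* y := s :* (α :* x :+ β :* y)) refl (sgn n) α β (L (suc p)) (L p) ⟩
      sgn n * (α * L (suc p) + β * L p)
        ≈⟨ γ-lucas ⟩
      γ ∎

    -- One summand of γ carries a factor a; the other carries U_(n-2), which has odd index and so
    -- vanishes together with the parameter (n-1) a.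
    γ-vanishes : a ≈ 0# → ¬ 2 ∣ n → γ ≈ 0#
    γ-vanishes a≈0 2∤n = trans (*-congˡ (trans
      (+-cong (trans (*-congʳ L-odd) (zeroˡ _))
        (-‿cong (trans (*-congʳ (trans (*-congʳ (trans (*-congˡ a≈0) (zeroʳ _))) (zeroˡ _))) (zeroˡ _))))
      (-‿inverseʳ 0#))) (zeroʳ _)
      where
      L-odd : L (suc (suc p)) ≈ 0#
      L-odd with parity p
      ... | inj₁ (k , ≡.refl) = contradiction
        (≡.subst (2 ∣_) (≡.cong (suc ∘ suc) (≡.trans (ℕₚ.+-suc k (suc k)) (≡.cong suc (ℕₚ.+-suc k k)))) (2∣k+k (suc (suc k)))) 2∤n
      ... | inj₂ (k , ≡.refl) = trans (reflexive (≡.cong (L ∘ suc ∘ suc) (≡.sym (ℕₚ.+-suc k k))))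
        (lucas-odd _ (suc k) (trans (*-congˡ a≈0) (zeroʳ _)))

    rhs₂-cong : ∀ {γ₁ γ₂} → γ₁ ≈ γ₂ → rhs₂ n a b t γ₁ ≈ rhs₂ n a b t γ₂
    rhs₂-cong γ₁≈γ₂ = *-congˡ (+-congʳ (+-congˡ (*-congʳ γ₁≈γ₂)))

theorem3 : ∀ {c ℓ : Level} (F : Char0Field c ℓ) →
    let open Char0Field F
        open FieldDefs F
    in (n : ℕ) (a b t : Carrier) →
       (n ≡ 3 → Δfc n a b t ≈ rhs₁ a b t)
       × (4 ≤ n → ((¬ (a ≈ 0#)) ⊎ ((a ≈ 0#) × (2 ∣ n)) → Δfc n a b t ≈ rhs₂ n a b t (γsum n a b))
                  × ((a ≈ 0#) × (¬ (2 ∣ n)) → Δfc n a b t ≈ rhs₂ n a b t 0#))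
theorem3 F n a b t =
  (λ { ≡.refl → discriminant-cubic a b t }) ,
  λ { (s≤s (s≤s (s≤s (s≤s {n = p} z≤n)))) → let open GammaSum p a b t ; Δ≈ = ClosedForm.discriminant-closed (suc p) a b t in
    (λ hyp → trans Δ≈ (rhs₂-cong (sym (γsum-lucas hyp)))) ,
    (λ { (a≈0 , 2∤n) → trans Δ≈ (rhs₂-cong (γ-vanishes a≈0 2∤n)) }) }
  where
  open Char0Field F using (trans; sym)
  open FieldLemmas F
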